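{- For every $\varepsilon>0$ there is a constant $n_0$ such that the following holds. Suppose that $G$ is a bipartite graph with balanced bipartition $\{V_1,V_2\}$ (i.e. $\big||V_1|-|V_2|\big|\le 1$), that $G$ is $\varepsilon$-quasirandom, and that its edge density $d=d(V_1,V_2)$ satisfies $d>0$. If $0<\varepsilon<(d/4)^{16}$ and $n=|V(G)|\ge n_0$, then $$\tfrac14(1-10\varepsilon)\,\mathsf{e}(G)\le \mathsf{g}(G)\le \tfrac14(1+10\varepsilon)\,\mathsf{e}(G).$$
   Context: $\mathsf{e}(G)=|E(G)|$ and $\mathsf{g}(G)$ is the orientable genus of $G$. For $X,Y\subseteq V(G)$, $\mathsf{e}(X,Y)$ is the number of edges with one end in $X$ and the other in $Y$, and $d(X,Y)=\mathsf{e}(X,Y)/(|X||Y|)$. A bipartite graph $G$ with balanced bipartition $V_1,V_2$ is $\varepsilon$-quasirandom if for every $X\subseteq V_1$ and every $Y\subseteq V_2$, $\big|\mathsf{e}(X,Y)-|X||Y|\,d(V_1,V_2)\big|\le\varepsilon|V_1||V_2|$.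
   Formalization: The parameter ε ranges over the positive rational numbers instead of the positive reals; the orientable genus is expressed combinatorially, as the minimum over rotation systems of the genus given by Euler's formula. -}

module Defs where

open import Data.Nat as ℕ using (ℕ; zero; suc; _+_; _*_; _∸_; _≤ᵇ_)
open import Data.Nat.DivMod using (_/_)
open import Data.Fin using (Fin; toℕ)
import Data.Fin as Fin
open import Data.Bool using (Bool; true; false; _∧_; _∨_; not; if_then_else_)
open import Data.Vec using (lookup)
open import Data.Fin.Subset using (Subset; ∁; _⊆_; ∣_∣)
open import Data.Product using (_×_; _,_; Σ; ∃; ∃-syntax)
open import Data.Integer using (+_)
open import Data.Rational as ℚ using (ℚ; 0ℚ; 1ℚ)
open import Relation.Binary.PropositionalEquality using (_≡_)

record Graph (n : ℕ) : Set where
  field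
    adj    : Fin n → Fin n → Bool
    sym    : ∀ u v → adj u v ≡ adj v u
    irrefl : ∀ v → adj v v ≡ false
open Graph public

count : {n : ℕ} → (Fin n → Bool) → ℕ
count {zero}  f = 0
count {suc n} f = (if f Fin.zero then 1 else 0) + count (λ i → f (Fin.suc i))

allBelow : ℕ → (ℕ → Bool) → Bool
allBelow zero    p = true
allBelow (suc m) p = allBelow m p ∧ p m

anyFin : {n : ℕ} → (Fin n → Bool) → Bool
anyFin {zero}  f = false
anyFin {suc n} f = f Fin.zero ∨ anyFin (λ i → f (Fin.suc i))

iter : {A : Set} → (A → A) → ℕ → A → A
iter f zero    a = a
iter f (suc k) a = f (iter f k a)

ℕ→ℚ : ℕ → ℚ
ℕ→ℚ k = (+ k) ℚ./ 1

_^ℚ_ : ℚ → ℕ → ℚ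
q ^ℚ zero  = 1ℚ
q ^ℚ suc k = q ℚ.* (q ^ℚ k)

sumFin : {n : ℕ} → (Fin n → ℕ) → ℕ
sumFin {zero}  f = 0
sumFin {suc n} f = f Fin.zero + sumFin (λ i → f (Fin.suc i))

module _ {n : ℕ} (G : Graph n) where

  -- e(X,Y): number of pairs (x,y) with x ∈ X, y ∈ Y and xy ∈ E(G)
  -- (for disjoint X, Y this is the number of edges between X and Y)
  eXY : Subset n → Subset n → ℕ
  eXY X Y = sumFin (λ x → count (λ y → lookup X x ∧ lookup Y y ∧ adj G x y))

  eG : ℕ
  eG = sumFin (λ u → count (λ v → (suc (toℕ u) ≤ᵇ toℕ v) ∧ adj G u v))

  density : Subset n → Subset n → ℚ
  density X Y with ∣ X ∣ * ∣ Y ∣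
  ... | zero  = 0ℚ
  ... | suc m = (+ eXY X Y) ℚ./ suc m

  IsBipartition : Subset n → Set
  IsBipartition V₁ = ∀ u v → adj G u v ≡ true → lookup V₁ u ≡ not (lookup V₁ v)

  Quasirandom : ℚ → Subset n → Subset n → Set
  Quasirandom ε V₁ V₂ =
    ∀ (X Y : Subset n) → X ⊆ V₁ → Y ⊆ V₂ →
      ℚ.∣ ℕ→ℚ (eXY X Y) ℚ.- ℕ→ℚ (∣ X ∣ * ∣ Y ∣) ℚ.* density V₁ V₂ ∣
        ℚ.≤ ε ℚ.* ℕ→ℚ (∣ V₁ ∣ * ∣ V₂ ∣)

  -- Orientable genus, via rotation systems (combinatorial embeddings).

  -- ρ v is a rotation at v: a cyclic permutation of the neighbourhood N(v)
  -- (values of ρ v outside N(v) are irrelevant).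
  IsRotationSystem : (Fin n → Fin n → Fin n) → Set
  IsRotationSystem ρ =
    ∀ v → (∀ u → adj G v u ≡ true → adj G v (ρ v u) ≡ true)
        × (∀ u w → adj G v u ≡ true → adj G v w ≡ true →
             ∃[ k ] iter (ρ v) k u ≡ w)

  faceStep : (Fin n → Fin n → Fin n) → Fin n × Fin n → Fin n × Fin n
  faceStep ρ (u , v) = (v , ρ v u)

  dartIdx : Fin n × Fin n → ℕ
  dartIdx (u , v) = toℕ u * n + toℕ v

  -- number of faces = number of orbits of faceStep on the darts,
  -- counted as the darts that have least index in their orbit
  -- (every orbit has length ≤ n * n)
  faces : (Fin n → Fin n → Fin n) → ℕ
  faces ρ = sumFin (λ u → count (λ v → adj G u v ∧
              allBelow (n * n) (λ k → dartIdx (u , v) ≤ᵇ dartIdx (iter (faceStep ρ) k (u , v)))))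

  -- isolated vertices (each is a component with one face in any embedding)
  isolated : ℕ
  isolated = count (λ v → not (anyFin (adj G v)))

  reach : ℕ → Fin n → Fin n → Bool
  reach zero    u v = toℕ u ≡ᵇ toℕ v
    where open import Data.Nat using (_≡ᵇ_)
  reach (suc k) u v = reach k u v ∨ anyFin (λ w → reach k u w ∧ adj G w v)

  -- number of connected components: vertices that are the least
  -- vertex of their component
  components : ℕ
  components = count (λ v → not (anyFin (λ u → (suc (toℕ u) ≤ᵇ toℕ v) ∧ reach n u v)))

  -- genus of the embedding given by ρ (Euler's formula, summed over the
  -- components):  2·c − 2·g = n − e + F
  genusOf : (Fin n → Fin n → Fin n) → ℕ
  genusOf ρ = (2 * components + eG ∸ (n + (faces ρ + isolated))) / 2

  IsGenus : ℕ → Set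
  IsGenus g = (∃[ ρ ] (IsRotationSystem ρ × genusOf ρ ≡ g))
            × (∀ ρ → IsRotationSystem ρ → g ℕ.≤ genusOf ρ)

{-# OPTIONS --safe #-}

-- Lower bound: in a bipartite graph a facial walk has length at least 4, except around components K₂,
-- so there are at most e/2 + n faces, and Euler's formula gives g ≥ e/4 - O(n).
--
-- Upper bound: cut V₁ into chunks of a constant size s. For a chunk C and a set S ⊆ C, the vertices of V₂
-- whose set of neighbours in C is S form a biclique with S, and these bicliques partition the edges.
-- A vertex of V₂ lies in at most n/s + 1 of them and a vertex of V₁ in at most 2^s.
-- Order both sides of a biclique, and let its rows (columns) be traversed upwards or downwards according
-- to the parity of their position: then facial walks which do not leave the biclique are quadrilaterals.
-- Concatenating, at each vertex, the orders coming from the bicliques gives a rotation system in which all but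
-- O(n (n/s + 2^s)) darts lie on quadrilaterals, so it has at least e/2 - O(n²/s) faces. As e is at least a
-- constant (depending on ε) times n², the errors are at most 10 ε e once s and n are large.
module Submission where

open import Defs hiding (sym)
open import Algebra.Properties.CommutativeMonoid.Sum using (sum; ∑-distrib-+; ∑-comm; sum-permute)
open import Data.Bool using (Bool; true; false; _∧_; not; if_then_else_)
open import Data.Bool.Properties using (∧-comm; not-involutive)
open import Data.Empty using (⊥; ⊥-elim)
open import Data.Fin using (Fin; toℕ; zero; suc; fromℕ<; combine)
open import Data.Fin.Permutation using (Permutation′; permutation; _⟨$⟩ʳ_)
import Data.Fin.Properties as Fin
open import Data.Fin.Subset using (Subset; ∁; ∣_∣)
open import Data.Fin.Subset.Properties using (∣∁p∣≡n∸∣p∣; ∣p∣≤n)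
import Data.Integer as ℤ
import Data.Integer.Properties as ℤₚ
open import Data.Nat using (ℕ; _≤_)
import Data.Nat as N
import Data.Nat.Properties as Nₚ
open import Data.Nat.Tactic.RingSolver using (solve-∀)
open import Data.Product using (∃-syntax; _×_; _,_; proj₁; proj₂; uncurry)
open import Data.Sum using (_⊎_; inj₁; inj₂)
open import Data.Vec using (lookup)
open import Data.Vec.Properties using (lookup-map)
open import Function using (_∘_; case_of_)
open import Relation.Binary.Definitions using (tri<; tri≈; tri>)
open import Relation.Binary.PropositionalEquality using (_≡_; _≢_; refl; sym; trans; cong; cong₂; subst; subst₂; module ≡-Reasoning)
open import Relation.Nullary using (¬_; Dec; does; yes; no; contradiction)
open import Relation.Nullary.Decidable using (dec-true; dec-false)

module Combinatorics where

  open import Data.Nat using (zero; suc; _+_; _*_; _∸_; _^_; _<_; z≤n; s≤s; s≤s⁻¹; _≤ᵇ_; _≤?_; _<?_; NonZero)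
  open import Data.Nat.DivMod using (_/_; _%_; m≡m%n+[m/n]*n; m%n<n; /-monoˡ-≤; m/n*n≤m)
  open import Data.Nat.Properties

  private variable n : ℕ

  ⟦_⟧ : Bool → ℕ
  ⟦ b ⟧ = if b then 1 else 0

  ⟦⟧≤1 : ∀ b → ⟦ b ⟧ ≤ 1
  ⟦⟧≤1 true  = ≤-refl
  ⟦⟧≤1 false = z≤n

  ∧-split : ∀ {a b} → a ∧ b ≡ true → a ≡ true × b ≡ true
  ∧-split {true} {true} refl = refl , refl

  ∧-join : ∀ {a b} → a ≡ true → b ≡ true → a ∧ b ≡ true
  ∧-join refl refl = refl

  true≢false : ∀ {b} → b ≡ true → b ≡ false → ⊥
  true≢false refl ()

  iff⇒≡ : ∀ {a b} → (a ≡ true → b ≡ true) → (b ≡ true → a ≡ true) → a ≡ b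
  iff⇒≡ {true}  {b}     f g = sym (f refl)
  iff⇒≡ {false} {true}  f g = g refl
  iff⇒≡ {false} {false} f g = refl

  does⇒ : ∀ {p} {P : Set p} (d : Dec P) → does d ≡ true → P
  does⇒ (yes p) _ = p

  ≤ᵇ-true : ∀ {a b} → a ≤ b → (a ≤ᵇ b) ≡ true
  ≤ᵇ-true {a} {b} = dec-true (a ≤? b)

  ≤ᵇ-true⁻¹ : ∀ {a b} → (a ≤ᵇ b) ≡ true → a ≤ b
  ≤ᵇ-true⁻¹ {a} {b} = does⇒ (a ≤? b)

  -- Finite sums

  sumFin-sum : (f : Fin n → ℕ) → sumFin f ≡ sum +-0-commutativeMonoid f
  sumFin-sum {zero}  f = refl
  sumFin-sum {suc n} f = cong (f zero +_) (sumFin-sum (f ∘ suc))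

  sumFin-cong : {f g : Fin n → ℕ} → (∀ i → f i ≡ g i) → sumFin f ≡ sumFin g
  sumFin-cong {zero}  h = refl
  sumFin-cong {suc n} h = cong₂ _+_ (h zero) (sumFin-cong (h ∘ suc))

  sumFin-mono : {f g : Fin n → ℕ} → (∀ i → f i ≤ g i) → sumFin f ≤ sumFin g
  sumFin-mono {zero}  h = z≤n
  sumFin-mono {suc n} h = +-mono-≤ (h zero) (sumFin-mono (h ∘ suc))

  sumFin-const : ∀ n c → sumFin {n} (λ _ → c) ≡ n * c
  sumFin-const zero    c = refl
  sumFin-const (suc n) c = cong (c +_) (sumFin-const n c)

  sumFin-≤ : {f : Fin n → ℕ} {c : ℕ} → (∀ i → f i ≤ c) → sumFin f ≤ n * c
  sumFin-≤ {n} {c = c} h = ≤-trans (sumFin-mono h) (≤-reflexive (sumFin-const n c))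

  sumFin-+ : (f g : Fin n → ℕ) → sumFin (λ i → f i + g i) ≡ sumFin f + sumFin g
  sumFin-+ f g = trans (sumFin-sum (λ i → f i + g i)) (trans (∑-distrib-+ +-0-commutativeMonoid f g)
    (sym (cong₂ _+_ (sumFin-sum f) (sumFin-sum g))))

  sumFin-swap : {m : ℕ} (f : Fin m → Fin n → ℕ) →
    sumFin (λ i → sumFin (f i)) ≡ sumFin (λ j → sumFin (λ i → f i j))
  sumFin-swap f = trans (double f) (trans (∑-comm +-0-commutativeMonoid f) (sym (double (λ j i → f i j))))
    where
    double : {k l : ℕ} (g : Fin k → Fin l → ℕ) →
      sumFin (λ i → sumFin (g i)) ≡ sum +-0-commutativeMonoid (λ i → sum +-0-commutativeMonoid (g i))
    double g = trans (sumFin-cong (λ i → sumFin-sum (g i))) (sumFin-sum (λ i → sum +-0-commutativeMonoid (g i)))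

  sumFin-permute : (f : Fin n → ℕ) (π : Permutation′ n) → sumFin (f ∘ (π ⟨$⟩ʳ_)) ≡ sumFin f
  sumFin-permute f π = trans (sumFin-sum (f ∘ (π ⟨$⟩ʳ_)))
    (trans (sym (sum-permute +-0-commutativeMonoid f π)) (sym (sumFin-sum f)))

  sumFin-term : (f : Fin n → ℕ) (i : Fin n) → f i ≤ sumFin f
  sumFin-term f zero    = m≤m+n _ _
  sumFin-term f (suc i) = ≤-trans (sumFin-term (f ∘ suc) i) (m≤n+m _ _)

  count-sumFin : (f : Fin n → Bool) → count f ≡ sumFin (λ i → ⟦ f i ⟧)
  count-sumFin {zero}  f = refl
  count-sumFin {suc n} f = cong (⟦ f zero ⟧ +_) (count-sumFin (f ∘ suc))

  count-cong : {f g : Fin n → Bool} → (∀ i → f i ≡ g i) → count f ≡ count g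
  count-cong {f = f} {g} h = trans (count-sumFin f)
    (trans (sumFin-cong (λ i → cong ⟦_⟧ (h i))) (sym (count-sumFin g)))

  count≤n : (f : Fin n → Bool) → count f ≤ n
  count≤n {n} f = ≤-trans (≤-reflexive (count-sumFin f))
    (≤-trans (sumFin-≤ (λ i → ⟦⟧≤1 (f i))) (≤-reflexive (*-identityʳ n)))

  count-none : (f : Fin n → Bool) → (∀ i → f i ≡ false) → count f ≡ 0
  count-none {zero}  f h = refl
  count-none {suc n} f h rewrite h zero = count-none (f ∘ suc) (h ∘ suc)

  count-unique : (f : Fin n → Bool) → (∀ i j → f i ≡ true → f j ≡ true → i ≡ j) → count f ≤ 1
  count-unique {zero}  f h = z≤n
  count-unique {suc n} f h with f zero in eq
  ... | false = count-unique (f ∘ suc) (λ i j p q → Fin.suc-injective (h _ _ p q))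
  ... | true  = s≤s (≤-reflexive (count-none (f ∘ suc) none))
    where
    none : ∀ i → f (suc i) ≡ false
    none i with f (suc i) in eqi
    ... | false = refl
    ... | true  with () ← h zero (suc i) eq eqi

  -- Double counting of the incidences `hit`: a counted element meets the column of its key, and
  -- injectivity leaves at most one element in each of the `B` columns.
  count-injective : (f : Fin n → Bool) (κ : Fin n → ℕ) (B : ℕ) →
    (∀ i → κ i < B) →
    (∀ i j → f i ≡ true → f j ≡ true → κ i ≡ κ j → i ≡ j) → count f ≤ B
  count-injective {n} f κ B κ<B inj = begin
    count f                                                    ≡⟨ count-sumFin f ⟩
    sumFin (λ i → ⟦ f i ⟧)                                     ≤⟨ sumFin-mono spread ⟩
    sumFin (λ i → sumFin {B} (λ k → ⟦ hit i k ⟧))              ≡⟨ sumFin-swap (λ i k → ⟦ hit i k ⟧) ⟩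
    sumFin {B} (λ k → sumFin (λ i → ⟦ hit i k ⟧))              ≤⟨ sumFin-≤ column ⟩
    B * 1                                                      ≡⟨ *-identityʳ B ⟩
    B                                                          ∎
    where
    open ≤-Reasoning
    hit : Fin n → Fin B → Bool
    hit i k = f i ∧ does (κ i ≟ toℕ k)
    spread : ∀ i → ⟦ f i ⟧ ≤ sumFin {B} (λ k → ⟦ hit i k ⟧)
    spread i = ≤-trans (≤-reflexive (sym here)) (sumFin-term (λ k → ⟦ hit i k ⟧) (fromℕ< (κ<B i)))
      where
      here : ⟦ hit i (fromℕ< (κ<B i)) ⟧ ≡ ⟦ f i ⟧
      here with f i
      ... | false = refl
      ... | true  = cong ⟦_⟧ (dec-true (κ i ≟ _) (sym (Fin.toℕ-fromℕ< (κ<B i))))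
    column : ∀ k → sumFin (λ i → ⟦ hit i k ⟧) ≤ 1
    column k = ≤-trans (≤-reflexive (sym (count-sumFin (λ i → hit i k))))
      (count-unique _ λ i j p q →
        let fi , ki = ∧-split {f i} p ; fj , kj = ∧-split {f j} q in
        inj i j fi fj (trans (does⇒ (κ i ≟ _) ki) (sym (does⇒ (κ j ≟ _) kj))))

  -- Iterates

  iter-+ : {A : Set} (f : A → A) (i j : ℕ) (a : A) → iter f (i + j) a ≡ iter f i (iter f j a)
  iter-+ f zero    j a = refl
  iter-+ f (suc i) j a = cong f (iter-+ f i j a)

  iter-comm : {A : Set} (f : A → A) (i : ℕ) (a : A) → iter f i (f a) ≡ f (iter f i a)
  iter-comm f zero    a = refl
  iter-comm f (suc i) a = cong f (iter-comm f i a)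

  iter-* : {A : Set} (f : A → A) (i j : ℕ) (a : A) → iter f j a ≡ a → iter f (i * j) a ≡ a
  iter-* f zero    j a h = refl
  iter-* f (suc i) j a h = trans (iter-+ f j (i * j) a) (trans (cong (iter f j) (iter-* f i j a h)) h)

  allBelow-intro : ∀ m (p : ℕ → Bool) → (∀ k → p k ≡ true) → allBelow m p ≡ true
  allBelow-intro zero    p h = refl
  allBelow-intro (suc m) p h = ∧-join (allBelow-intro m p h) (h m)

  allBelow-elim : ∀ m (p : ℕ → Bool) → allBelow m p ≡ true → ∀ {k} → k < m → p k ≡ true
  allBelow-elim (suc m) p h {k} k<1+m with ∧-split {allBelow m p} h | m≤n⇒m<n∨m≡n (s≤s⁻¹ k<1+m)
  ... | below , _  | inj₁ k<m  = allBelow-elim m p below k<m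
  ... | _     , pm | inj₂ refl = pm

  -- Darts and their number.

  module _ {n : ℕ} (G : Graph n) where

    Dart : Set
    Dart = Fin n × Fin n

    IsDart : Dart → Set
    IsDart (u , v) = adj G u v ≡ true

    IsDart-sym : ∀ {u v} → adj G u v ≡ true → adj G v u ≡ true
    IsDart-sym {u} {v} p = trans (Graph.sym G v u) p

    -- Sums over the darts

    dartSum : (Dart → ℕ) → ℕ
    dartSum φ = sumFin λ u → sumFin λ v → if adj G u v then φ (u , v) else 0

    dartSum-mono : {φ ψ : Dart → ℕ} → (∀ D → IsDart D → φ D ≤ ψ D) → dartSum φ ≤ dartSum ψ
    dartSum-mono {φ} {ψ} h = sumFin-mono λ u → sumFin-mono λ v → pointwise u v
      where
      pointwise : ∀ u v → (if adj G u v then φ (u , v) else 0) ≤ (if adj G u v then ψ (u , v) else 0)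
      pointwise u v with adj G u v in eq
      ... | true  = h (u , v) eq
      ... | false = z≤n

    dartSum-+ : (φ ψ : Dart → ℕ) → dartSum (λ D → φ D + ψ D) ≡ dartSum φ + dartSum ψ
    dartSum-+ φ ψ = trans (sumFin-cong λ u → trans (sumFin-cong (pointwise u)) (sumFin-+ (row φ u) (row ψ u)))
                          (sumFin-+ (λ u → sumFin (row φ u)) (λ u → sumFin (row ψ u)))
      where
      row : (Dart → ℕ) → Fin n → Fin n → ℕ
      row χ u v = if adj G u v then χ (u , v) else 0
      pointwise : ∀ u v → row (λ D → φ D + ψ D) u v ≡ row φ u v + row ψ u v
      pointwise u v with adj G u v
      ... | true  = refl
      ... | false = refl

    -- An edge carries two darts, one going up and one going down in the order of the vertices;
    -- swapping the summations identifies the two sums.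
    dartSum-1 : dartSum (λ _ → 1) ≡ 2 * eG G
    dartSum-1 = begin
      dartSum (λ _ → 1)
        ≡⟨ sumFin-cong (λ u → trans (sumFin-cong (split u)) (sumFin-+ (up u) (λ v → up v u))) ⟩
      sumFin (λ u → sumFin (up u) + sumFin (λ v → up v u))
        ≡⟨ sumFin-+ (λ u → sumFin (up u)) (λ u → sumFin (λ v → up v u)) ⟩
      sumFin (λ u → sumFin (up u)) + sumFin (λ u → sumFin (λ v → up v u))
        ≡⟨ cong (sumFin (λ u → sumFin (up u)) +_) (sumFin-swap (λ u v → up v u)) ⟩
      sumFin (λ u → sumFin (up u)) + sumFin (λ u → sumFin (up u))    ≡⟨ cong₂ _+_ (sym up-sum) (sym up-sum) ⟩
      eG G + eG G                                                    ≡⟨ cong (eG G +_) (sym (+-identityʳ (eG G))) ⟩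
      2 * eG G                                                       ∎
      where
      open ≡-Reasoning
      up : Fin n → Fin n → ℕ
      up u v = ⟦ (suc (toℕ u) ≤ᵇ toℕ v) ∧ adj G u v ⟧
      up-sum : eG G ≡ sumFin (λ u → sumFin (up u))
      up-sum = sumFin-cong λ u → count-sumFin (λ v → (suc (toℕ u) ≤ᵇ toℕ v) ∧ adj G u v)
      split : ∀ u v → (if adj G u v then 1 else 0) ≡ up u v + up v u
      split u v rewrite Graph.sym G v u with adj G u v in eq
      ... | false rewrite ∧-comm (suc (toℕ u) ≤ᵇ toℕ v) false | ∧-comm (suc (toℕ v) ≤ᵇ toℕ u) false = refl
      ... | true with <-cmp (toℕ u) (toℕ v)
      ...   | tri< u<v _ v≮u rewrite ≤ᵇ-true u<v | dec-false (suc (toℕ v) ≤? toℕ u) v≮u = refl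
      ...   | tri> u≮v _ v<u rewrite ≤ᵇ-true v<u | dec-false (suc (toℕ u) ≤? toℕ v) u≮v = refl
      ...   | tri≈ _ u≡v _ with refl ← Fin.toℕ-injective u≡v = ⊥-elim (true≢false eq (Graph.irrefl G u))

    dartIdx-injective : ∀ D E → dartIdx G D ≡ dartIdx G E → D ≡ E
    dartIdx-injective (u , v) (x , y) eq =
      uncurry (cong₂ _,_) (Fin.combine-injective u v x y (Fin.toℕ-injective
        (trans (idx u v) (trans eq (sym (idx x y))))))
      where
      idx : ∀ u v → toℕ (combine u v) ≡ dartIdx G (u , v)
      idx u v = trans (Fin.toℕ-combine u v) (cong (_+ toℕ v) (*-comm n (toℕ u)))

    -- The face permutation of a rotation system.

    module Rotation (ρ : Fin n → Fin n → Fin n) (rot : IsRotationSystem G ρ) where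

      ρ-adj : ∀ {v u} → adj G v u ≡ true → adj G v (ρ v u) ≡ true
      ρ-adj {v} {u} = proj₁ (rot v) u

      reaches : ∀ {v u w} → adj G v u ≡ true → adj G v w ≡ true → ∃[ k ] iter (ρ v) k u ≡ w
      reaches {v} = proj₂ (rot v) _ _

      iter-adj : ∀ {v u} k → adj G v u ≡ true → adj G v (iter (ρ v) k u) ≡ true
      iter-adj zero    a = a
      iter-adj (suc k) a = ρ-adj (iter-adj k a)

      -- Both u and u′ are periodic, so they agree with a common iterate of ρ v u = ρ v u′.
      ρ-injective : ∀ {v u u′} → adj G v u ≡ true → adj G v u′ ≡ true → ρ v u ≡ ρ v u′ → u ≡ u′
      ρ-injective {v} {u} {u′} a a′ eq = begin
        u                            ≡⟨ iter-* (ρ v) (suc k′) (suc k) u (trans (sym (iter-comm (ρ v) k u)) p) ⟨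
        iter (ρ v) m u               ≡⟨ iter-comm (ρ v) (k + k′ * suc k) u ⟨
        iter (ρ v) (k + k′ * suc k) (ρ v u)  ≡⟨ cong (iter (ρ v) (k + k′ * suc k)) eq ⟩
        iter (ρ v) (k + k′ * suc k) (ρ v u′) ≡⟨ iter-comm (ρ v) (k + k′ * suc k) u′ ⟩
        iter (ρ v) m u′              ≡⟨ cong (λ i → iter (ρ v) i u′) (*-comm (suc k′) (suc k)) ⟩
        iter (ρ v) (suc k * suc k′) u′ ≡⟨ iter-* (ρ v) (suc k) (suc k′) u′ (trans (sym (iter-comm (ρ v) k′ u′)) p′) ⟩
        u′                           ∎
        where
        open ≡-Reasoning
        k  = proj₁ (reaches (ρ-adj a) a)
        p  = proj₂ (reaches (ρ-adj a) a)
        k′ = proj₁ (reaches (ρ-adj a′) a′)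
        p′ = proj₂ (reaches (ρ-adj a′) a′)
        m  = suc k′ * suc k

      private
        -- A rotation is controlled only on the neighbourhood of `v`. Extending it by the identity
        -- gives a permutation of all vertices, as reindexing a sum requires.
        r : Fin n → Fin n → Fin n
        r v u = if adj G v u then ρ v u else u

        r-adj : ∀ v u → adj G v (r v u) ≡ adj G v u
        r-adj v u with adj G v u in eq
        ... | true  = ρ-adj eq
        ... | false = eq

        r-true : ∀ {v u} → adj G v u ≡ true → r v u ≡ ρ v u
        r-true eq rewrite eq = refl

        r-false : ∀ {v u} → adj G v u ≡ false → r v u ≡ u
        r-false eq rewrite eq = refl

        preimage : ∀ v w → ∃[ u ] r v u ≡ w
        preimage v w with adj G v w in eq
        ... | false = w , r-false eq
        ... | true  = let k , p = reaches (ρ-adj eq) eq in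
          iter (ρ v) k w , trans (r-true (iter-adj k eq)) (trans (sym (iter-comm (ρ v) k w)) p)

        r-injective : ∀ v {u u′} → r v u ≡ r v u′ → u ≡ u′
        r-injective v {u} {u′} eq with adj G v u in a | adj G v u′ in a′
        ... | true  | true  = ρ-injective a a′ eq
        ... | false | false = eq
        ... | true  | false = ⊥-elim (true≢false (subst (λ x → adj G v x ≡ true) eq (ρ-adj a)) a′)
        ... | false | true  = ⊥-elim (true≢false (subst (λ x → adj G v x ≡ true) (sym eq) (ρ-adj a′)) a)

        r-perm : Fin n → Permutation′ n
        r-perm v = permutation (r v) (proj₁ ∘ preimage v) (proj₂ ∘ preimage v)
          (λ u → r-injective v (proj₂ (preimage v (r v u))))

      step : Dart → Dart
      step = faceStep G ρ

      step-dart : ∀ {D} → IsDart D → IsDart (step D)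
      step-dart {u , v} a = ρ-adj (IsDart-sym a)

      iter-dart : ∀ {D} k → IsDart D → IsDart (iter step k D)
      iter-dart zero    a = a
      iter-dart (suc k) a = step-dart (iter-dart k a)

      step-injective : ∀ {D E} → IsDart D → IsDart E → step D ≡ step E → D ≡ E
      step-injective {u , v} {x , y} a b eq with refl ← cong proj₁ eq =
        cong (_, v) (ρ-injective (IsDart-sym a) (IsDart-sym b) (cong proj₂ eq))

      -- For a fixed `v`, the rotation at `v` matches the darts into `v` with the darts out of `v`,
      -- so each inner sum is only reindexed.
      dartSum-step : (φ : Dart → ℕ) → dartSum (φ ∘ step) ≡ dartSum φ
      dartSum-step φ = begin
        dartSum (φ ∘ step)
          ≡⟨ sumFin-swap (λ u v → if adj G u v then φ (v , ρ v u) else 0) ⟩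
        sumFin (λ v → sumFin (λ u → if adj G u v then φ (v , ρ v u) else 0))
          ≡⟨ sumFin-cong (λ v → sumFin-cong (pointwise v)) ⟩
        sumFin (λ v → sumFin (λ u → row v (r v u)))
          ≡⟨ sumFin-cong (λ v → sumFin-permute (row v) (r-perm v)) ⟩
        dartSum φ                                                                  ∎
        where
        open ≡-Reasoning
        row : Fin n → Fin n → ℕ
        row v w = if adj G v w then φ (v , w) else 0
        pointwise : ∀ v u → (if adj G u v then φ (v , ρ v u) else 0) ≡ row v (r v u)
        pointwise v u rewrite Graph.sym G u v | r-adj v u with adj G v u
        ... | true  = refl
        ... | false = refl

      -- The weight of a window of four consecutive darts of a facial walk. Both bounds on the
      -- number of faces come from averaging over these windows.
      fourSum : (Dart → ℕ) → Dart → ℕ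
      fourSum φ D = φ D + (φ (iter step 1 D) + (φ (iter step 2 D) + φ (iter step 3 D)))

      dartSum-fourSum : (φ : Dart → ℕ) → dartSum (fourSum φ) ≡ 4 * dartSum φ
      dartSum-fourSum φ = begin
        dartSum (fourSum φ)  ≡⟨ dartSum-+ φ (λ D → φ₁ D + (φ₂ D + φ₃ D)) ⟩
        S + dartSum (λ D → φ₁ D + (φ₂ D + φ₃ D)) ≡⟨ cong (S +_) (dartSum-+ φ₁ (λ D → φ₂ D + φ₃ D)) ⟩
        S + (dartSum φ₁ + dartSum (λ D → φ₂ D + φ₃ D)) ≡⟨ cong (λ x → S + (dartSum φ₁ + x)) (dartSum-+ φ₂ φ₃) ⟩
        S + (dartSum φ₁ + (dartSum φ₂ + dartSum φ₃)) ≡⟨ cong (S +_) (cong₂ _+_ e₁ (cong₂ _+_ e₂ e₃)) ⟩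
        S + (S + (S + S)) ≡⟨ cong (λ x → S + (S + (S + x))) (+-identityʳ S) ⟨
        4 * S ∎
        where
        open ≡-Reasoning
        φ₁ φ₂ φ₃ : Dart → ℕ
        φ₁ = φ ∘ iter step 1
        φ₂ = φ ∘ iter step 2
        φ₃ = φ ∘ iter step 3
        S = dartSum φ
        e₁ : dartSum φ₁ ≡ S
        e₁ = dartSum-step φ
        e₂ : dartSum φ₂ ≡ S
        e₂ = trans (dartSum-step φ₁) e₁
        e₃ : dartSum φ₃ ≡ S
        e₃ = trans (dartSum-step φ₂) e₂

      isLeast : Dart → Bool
      isLeast D = allBelow (n * n) (λ k → dartIdx G D ≤ᵇ dartIdx G (iter step k D))

      faces-dartSum : faces G ρ ≡ dartSum (⟦_⟧ ∘ isLeast)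
      faces-dartSum = sumFin-cong λ u → trans (count-sumFin (λ v → adj G u v ∧ isLeast (u , v))) (sumFin-cong (pointwise u))
        where
        pointwise : ∀ u v → ⟦ adj G u v ∧ isLeast (u , v) ⟧ ≡ (if adj G u v then ⟦ isLeast (u , v) ⟧ else 0)
        pointwise u v with adj G u v
        ... | true  = refl
        ... | false = refl

  -- An upper bound on the number of faces of a bipartite graph.

  module _ {n : ℕ} (G : Graph n) where
    module _ (ρ : Fin n → Fin n → Fin n) (rot : IsRotationSystem G ρ) where
      open Rotation G ρ rot

      iter-cancel : ∀ {D} i m → IsDart G D → iter step (i + m) D ≡ iter step i D → iter step m D ≡ D
      iter-cancel zero    m a eq = eq
      iter-cancel (suc i) m a eq = iter-cancel i m a (step-injective (iter-dart (i + m) a) (iter-dart i a) eq)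

      -- Pigeonhole on n * n + 1 iterates. The bound `n * n` matters because `isLeast` inspects only
      -- that many iterates.
      period : ∀ {D} → IsDart G D → ∃[ p ] (1 ≤ p × p ≤ n * n × iter step p D ≡ D)
      period {D} a with Fin.pigeonhole (n<1+n (n * n)) (λ i → uncurry combine (iter step (toℕ i) D))
      ... | i , j , i<j , eq = toℕ j ∸ toℕ i , m<n⇒0<n∸m i<j
          , ≤-trans (m∸n≤m (toℕ j) (toℕ i)) (s≤s⁻¹ (Fin.toℕ<n j))
          , iter-cancel (toℕ i) _ a (trans (cong (λ k → iter step k D) (m+[n∸m]≡n (<⇒≤ i<j))) (sym same))
        where
        same : iter step (toℕ i) D ≡ iter step (toℕ j) D
        same = uncurry (cong₂ _,_) (Fin.combine-injective _ _ _ _ eq)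

      -- Two least darts of the same orbit coincide.
      least-apart : ∀ {D} i → IsDart G D → 1 ≤ i → (∀ k → 1 ≤ k → k ≤ i → iter step k D ≢ D) →
        isLeast D ≡ true → isLeast (iter step i D) ≡ true → ⊥
      least-apart {D} i a 1≤i fresh ld li with period a
      ... | p , 1≤p , p≤nn , eq = fresh i 1≤i ≤-refl (sym (dartIdx-injective G _ _ (≤-antisym below above)))
        where
        i<p : i < p
        i<p = ≰⇒> λ p≤i → fresh p 1≤p p≤i eq
        below : dartIdx G D ≤ dartIdx G (iter step i D)
        below = ≤ᵇ-true⁻¹ (allBelow-elim (n * n) _ ld (<-≤-trans i<p p≤nn))
        -- The rest of the period leads from the later dart back to `D`, so the minimality of the
        -- later dart can be used as well.
        back : iter step (p ∸ i) (iter step i D) ≡ D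
        back = trans (sym (iter-+ step (p ∸ i) i D)) (trans (cong (λ k → iter step k D) (m∸n+n≡m (<⇒≤ i<p))) eq)
        p∸i<nn : p ∸ i < n * n
        p∸i<nn = <-≤-trans (∸-monoʳ-< 1≤i (<⇒≤ i<p)) p≤nn
        above : dartIdx G (iter step i D) ≤ dartIdx G D
        above = subst (λ E → dartIdx G (iter step i D) ≤ dartIdx G E) back
          (≤ᵇ-true⁻¹ (allBelow-elim (n * n) _ li p∸i<nn))

      turnsBack : Dart G → Bool
      turnsBack (u , v) = does (ρ v u Fin.≟ u)

      -- Averaged over all windows, this limits the marked darts to a quarter of all darts.
      fourSum≤1 : (b : Dart G → Bool) (D : Dart G) →
        (∀ j i → 1 ≤ i → i ≤ 3 → b (iter step j D) ≡ true → b (iter step i (iter step j D)) ≡ true → ⊥) →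
        fourSum (⟦_⟧ ∘ b) D ≤ 1
      fourSum≤1 b D excl
        with b D in e₀ | b (iter step 1 D) in e₁ | b (iter step 2 D) in e₂ | b (iter step 3 D) in e₃
      ... | true  | true  | _     | _     = ⊥-elim (excl 0 1 (s≤s z≤n) (s≤s z≤n) e₀ e₁)
      ... | true  | false | true  | _     = ⊥-elim (excl 0 2 (s≤s z≤n) (s≤s (s≤s z≤n)) e₀ e₂)
      ... | true  | false | false | true  = ⊥-elim (excl 0 3 (s≤s z≤n) (s≤s (s≤s (s≤s z≤n))) e₀ e₃)
      ... | false | true  | true  | _     = ⊥-elim (excl 1 1 (s≤s z≤n) (s≤s z≤n) e₁ e₂)
      ... | false | true  | false | true  = ⊥-elim (excl 1 2 (s≤s z≤n) (s≤s (s≤s z≤n)) e₁ e₃)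
      ... | false | false | true  | true  = ⊥-elim (excl 2 1 (s≤s z≤n) (s≤s z≤n) e₂ e₃)
      ... | true  | false | false | false = ≤-refl
      ... | false | true  | false | false = ≤-refl
      ... | false | false | true  | false = ≤-refl
      ... | false | false | false | b₃    = ⟦⟧≤1 b₃

      -- If the rotation at `v` fixes a neighbour, transitivity makes it the only neighbour; hence
      -- at most one such dart enters each vertex.
      dartSum-turnsBack : dartSum G (⟦_⟧ ∘ turnsBack) ≤ n
      dartSum-turnsBack = begin
        dartSum G (⟦_⟧ ∘ turnsBack)
          ≡⟨ sumFin-swap (λ u v → if adj G u v then ⟦ turnsBack (u , v) ⟧ else 0) ⟩
        sumFin (λ v → sumFin (λ u → if adj G u v then ⟦ turnsBack (u , v) ⟧ else 0))
          ≡⟨ sumFin-cong (λ v → sumFin-cong (pointwise v)) ⟩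
        sumFin (λ v → sumFin (λ u → ⟦ fixed v u ⟧))
          ≤⟨ sumFin-≤ (λ v → ≤-trans (≤-reflexive (sym (count-sumFin (fixed v)))) (count-unique (fixed v) (unique v))) ⟩
        n * 1                                           ≡⟨ *-identityʳ n ⟩
        n                                               ∎
        where
        open ≤-Reasoning
        fixed : Fin n → Fin n → Bool
        fixed v u = adj G v u ∧ turnsBack (u , v)
        pointwise : ∀ v u → (if adj G u v then ⟦ turnsBack (u , v) ⟧ else 0) ≡ ⟦ fixed v u ⟧
        pointwise v u rewrite Graph.sym G u v with adj G v u
        ... | true  = refl
        ... | false = refl
        stays : ∀ {v u} k → ρ v u ≡ u → iter (ρ v) k u ≡ u
        stays zero    eq = refl
        stays {v} (suc k) eq = trans (cong (ρ v) (stays k eq)) eq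
        unique : ∀ v i j → fixed v i ≡ true → fixed v j ≡ true → i ≡ j
        unique v i j p q with ∧-split {adj G v i} p | ∧-split {adj G v j} q
        ... | ai , fi | aj , _ with reaches ai aj
        ...   | k , eq = trans (sym (stays k (does⇒ (ρ v i Fin.≟ i) fi))) eq

      module _ (V₁ : Subset n) (bip : IsBipartition G V₁) where

        no-triangle : ∀ {u v w} → adj G u v ≡ true → adj G v w ≡ true → adj G w u ≡ true → ⊥
        no-triangle {u} {v} {w} p q r
          with lookup V₁ u | lookup V₁ v | lookup V₁ w | bip u v p | bip v w q | bip w u r
        ... | true  | false | true  | refl | refl | ()
        ... | false | true  | false | refl | refl | ()

        -- Period one would need a loop, period two a turn back, and period three a triangle.
        no-short-orbit : ∀ {D} → IsDart G D → turnsBack D ≡ false →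
          ∀ k → 1 ≤ k → k ≤ 3 → iter step k D ≢ D
        no-short-orbit {u , v} a t 1 _ _ eq with refl ← cong proj₁ eq = true≢false a (Graph.irrefl G u)
        no-short-orbit {u , v} a t 2 _ _ eq = true≢false (dec-true (ρ v u Fin.≟ u) (cong proj₁ eq)) t
        no-short-orbit {u , v} a t 3 _ _ eq =
          no-triangle a (step-dart a) (subst (λ x → adj G (ρ v u) x ≡ true) (cong proj₁ eq) (iter-dart 2 a))
        no-short-orbit a t (suc (suc (suc (suc k)))) _ (s≤s (s≤s (s≤s ()))) eq

        -- Each orbit is counted by its least dart. Least darts that do not turn back are at most a
        -- quarter of all darts, because no window of four contains two; at most `n` others turn
        -- back.
        faces-upper : 4 * faces G ρ ≤ 2 * eG G + 4 * n
        faces-upper = begin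
          4 * faces G ρ                                                    ≡⟨ cong (4 *_) faces-dartSum ⟩
          4 * dartSum G (⟦_⟧ ∘ isLeast)
            ≤⟨ *-monoʳ-≤ 4 (dartSum-mono G (λ D _ → split D)) ⟩
          4 * dartSum G (λ D → ⟦ proper D ⟧ + ⟦ turnsBack D ⟧)
            ≡⟨ cong (4 *_) (dartSum-+ G (⟦_⟧ ∘ proper) (⟦_⟧ ∘ turnsBack)) ⟩
          4 * (dartSum G (⟦_⟧ ∘ proper) + dartSum G (⟦_⟧ ∘ turnsBack))     ≡⟨ *-distribˡ-+ 4 (dartSum G (⟦_⟧ ∘ proper)) _ ⟩
          4 * dartSum G (⟦_⟧ ∘ proper) + 4 * dartSum G (⟦_⟧ ∘ turnsBack)
            ≤⟨ +-mono-≤ proper-bound (*-monoʳ-≤ 4 dartSum-turnsBack) ⟩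
          2 * eG G + 4 * n                                                 ∎
          where
          open ≤-Reasoning
          proper : Dart G → Bool
          proper D = isLeast D ∧ not (turnsBack D)
          split : ∀ D → ⟦ isLeast D ⟧ ≤ ⟦ proper D ⟧ + ⟦ turnsBack D ⟧
          split D with isLeast D | turnsBack D
          ... | true  | true  = ≤-refl
          ... | true  | false = ≤-refl
          ... | false | _     = z≤n
          not-true : ∀ {b} → not b ≡ true → b ≡ false
          not-true {false} _ = refl
          exclusive : ∀ {D} → IsDart G D → ∀ i → 1 ≤ i → i ≤ 3 → proper D ≡ true → proper (iter step i D) ≡ true → ⊥
          exclusive {D} a i 1≤i i≤3 p q =
            let ld , tb = ∧-split {isLeast D} p in
            least-apart i a 1≤i (λ k 1≤k k≤i → no-short-orbit a (not-true tb) k 1≤k (≤-trans k≤i i≤3))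
              ld (proj₁ (∧-split {isLeast (iter step i D)} q))
          proper-bound : 4 * dartSum G (⟦_⟧ ∘ proper) ≤ 2 * eG G
          proper-bound = ≤-trans (≤-reflexive (sym (dartSum-fourSum (⟦_⟧ ∘ proper))))
            (≤-trans (dartSum-mono G (λ D a → fourSum≤1 proper D (λ j → exclusive (iter-dart j a))))
              (≤-reflexive (dartSum-1 G)))

  -- A lower bound on the number of faces from quadrilaterals.

  argmin : (x : ℕ → ℕ) (m : ℕ) → ∃[ j ] (j ≤ m × (∀ i → i ≤ m → x j ≤ x i))
  argmin x zero = 0 , z≤n , λ { zero _ → ≤-refl }
  argmin x (suc m) with argmin x m
  ... | j , j≤m , least with ≤-total (x j) (x (suc m))
  ...   | inj₁ xj≤ = j , m≤n⇒m≤1+n j≤m , λ i i≤ → case m≤n⇒m<n∨m≡n i≤ of λ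
            { (inj₁ i<1+m) → least i (s≤s⁻¹ i<1+m) ; (inj₂ refl) → xj≤ }
  ...   | inj₂ ≤xj = suc m , ≤-refl , λ i i≤ → case m≤n⇒m<n∨m≡n i≤ of λ
            { (inj₁ i<1+m) → ≤-trans ≤xj (least i (s≤s⁻¹ i<1+m)) ; (inj₂ refl) → ≤-refl }

  module _ {n : ℕ} (G : Graph n) where
    module _ (ρ : Fin n → Fin n → Fin n) (rot : IsRotationSystem G ρ) where
      open Rotation G ρ rot

      -- On a walk that closes after four steps every iterate is one of the first four, so the
      -- smallest of these is least in the whole orbit.
      quadrilateral-least : ∀ {D} → iter step 4 D ≡ D → 1 ≤ fourSum (⟦_⟧ ∘ isLeast) D
      quadrilateral-least {D} closed with argmin (λ i → dartIdx G (iter step i D)) 3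
      ... | j , j≤3 , least = pick j j≤3 (allBelow-intro (n * n) _ λ k → ≤ᵇ-true (below k))
        where
        reduce : ∀ m → ∃[ i ] (i ≤ 3 × iter step m D ≡ iter step i D)
        reduce zero = 0 , z≤n , refl
        reduce (suc m) with reduce m
        ... | i , i≤3 , eq with m≤n⇒m<n∨m≡n i≤3
        ...   | inj₁ i<3  = suc i , i<3 , cong step eq
        ...   | inj₂ refl = 0 , z≤n , trans (cong step eq) closed
        below : ∀ k → dartIdx G (iter step j D) ≤ dartIdx G (iter step k (iter step j D))
        below k with reduce (k + j)
        ... | i , i≤3 , eq = subst (λ E → dartIdx G (iter step j D) ≤ dartIdx G E)
          (sym (trans (sym (iter-+ step k j D)) eq)) (least i i≤3)
        pick : ∀ j → j ≤ 3 → isLeast (iter step j D) ≡ true → 1 ≤ fourSum (⟦_⟧ ∘ isLeast) D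
        pick 0 _ e rewrite e = s≤s z≤n
        pick 1 _ e rewrite e = ≤-trans (s≤s z≤n) (m≤n+m _ ⟦ isLeast D ⟧)
        pick 2 _ e rewrite e = ≤-trans (≤-trans (s≤s z≤n) (m≤n+m _ ⟦ isLeast (iter step 1 D) ⟧)) (m≤n+m _ ⟦ isLeast D ⟧)
        pick 3 _ e rewrite e = ≤-trans (≤-trans (m≤n+m 1 ⟦ isLeast (iter step 2 D) ⟧)
          (m≤n+m _ ⟦ isLeast (iter step 1 D) ⟧)) (m≤n+m _ ⟦ isLeast D ⟧)
        pick (suc (suc (suc (suc _)))) (s≤s (s≤s (s≤s ()))) _

      -- For every dart, its window contains a least dart, or the dart is bad, or its successor is
      -- bad. Summation over the darts counts each least dart four times and each bad dart twice.
      faces-lower : (bad : Dart G → Bool) →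
        (∀ {D} → IsDart G D → bad D ≡ false → bad (step D) ≡ false → iter step 4 D ≡ D) →
        2 * eG G ≤ 4 * faces G ρ + 2 * dartSum G (⟦_⟧ ∘ bad)
      faces-lower bad closes = begin
        2 * eG G                                                   ≡⟨ dartSum-1 G ⟨
        dartSum G (λ _ → 1)                                        ≤⟨ dartSum-mono G pointwise ⟩
        dartSum G (λ D → four D + (⟦ bad D ⟧ + ⟦ bad (step D) ⟧))  ≡⟨ dartSum-+ G four (λ D → ⟦ bad D ⟧ + ⟦ bad (step D) ⟧) ⟩
        dartSum G four + dartSum G (λ D → ⟦ bad D ⟧ + ⟦ bad (step D) ⟧)
          ≡⟨ cong₂ _+_ (trans (dartSum-fourSum (⟦_⟧ ∘ isLeast)) (cong (4 *_) (sym faces-dartSum)))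
                       (trans (dartSum-+ G (⟦_⟧ ∘ bad) (⟦_⟧ ∘ bad ∘ step))
                         (cong (S +_) (trans (dartSum-step (⟦_⟧ ∘ bad)) (sym (+-identityʳ S))))) ⟩
        4 * faces G ρ + 2 * S                                      ∎
        where
        open ≤-Reasoning
        four : Dart G → ℕ
        four = fourSum (⟦_⟧ ∘ isLeast)
        S = dartSum G (⟦_⟧ ∘ bad)
        pointwise : ∀ D → IsDart G D → 1 ≤ four D + (⟦ bad D ⟧ + ⟦ bad (step D) ⟧)
        pointwise D a with bad D in e₀ | bad (step D) in e₁
        ... | true  | _     = ≤-trans (s≤s z≤n) (m≤n+m _ (four D))
        ... | false | true  = m≤n+m 1 (four D)
        ... | false | false = ≤-trans (quadrilateral-least (closes a e₀ e₁)) (m≤m+n (four D) 0)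

  -- Cyclic orders given by a key

  least : {n : ℕ} (Q : Fin n → Bool) (key : Fin n → ℕ) →
    (∃[ z ] (Q z ≡ true × (∀ w → Q w ≡ true → key z ≤ key w))) ⊎ (∀ w → Q w ≡ false)
  least {zero}  Q key = inj₂ λ ()
  least {suc n} Q key with least (Q ∘ suc) (key ∘ suc) | Q zero in q₀
  ... | inj₂ none           | false = inj₂ λ { zero → q₀ ; (suc w) → none w }
  ... | inj₂ none           | true  = inj₁ (zero , q₀ , λ
          { zero _ → ≤-refl ; (suc w) q → ⊥-elim (true≢false q (none w)) })
  ... | inj₁ (z , qz , min) | false = inj₁ (suc z , qz , λ
          { zero q → ⊥-elim (true≢false q q₀) ; (suc w) q → min w q })
  ... | inj₁ (z , qz , min) | true with ≤-total (key zero) (key (suc z))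
  ...   | inj₁ 0≤z = inj₁ (zero , q₀ , λ { zero _ → ≤-refl ; (suc w) q → ≤-trans 0≤z (min w q) })
  ...   | inj₂ z≤0 = inj₁ (suc z , qz , λ { zero _ → z≤0 ; (suc w) q → min w q })

  module Cyclic {n : ℕ} (N : Fin n → Bool) (key : Fin n → ℕ)
    (key-injective : ∀ {u w} → N u ≡ true → N w ≡ true → key u ≡ key w → u ≡ w) where

    above : Fin n → Fin n → Bool
    above u z = N z ∧ (suc (key u) ≤ᵇ key z)

    -- The largest key is followed by the smallest one. The final default `u` occurs only when `N`
    -- is empty.
    next : Fin n → Fin n
    next u with least (above u) key
    ... | inj₁ (z , _) = z
    ... | inj₂ _ with least N key
    ...   | inj₁ (z , _) = z
    ...   | inj₂ _       = u

    next-closed : ∀ {u} → N u ≡ true → N (next u) ≡ true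
    next-closed {u} a with least (above u) key
    ... | inj₁ (z , q , _) = proj₁ (∧-split q)
    ... | inj₂ _ with least N key
    ...   | inj₁ (z , q , _) = q
    ...   | inj₂ _           = a

    next-unique : ∀ {u x} → N x ≡ true → key u < key x →
      (∀ z → N z ≡ true → key u < key z → key x ≤ key z) → next u ≡ x
    next-unique {u} {x} nx u<x min with least (above u) key
    ... | inj₁ (z , q , minz) = let nz , u<z = ∧-split {N z} q in
          key-injective nz nx (≤-antisym (minz x (∧-join nx (≤ᵇ-true u<x))) (min z nz (≤ᵇ-true⁻¹ u<z)))
    ... | inj₂ none = ⊥-elim (true≢false (∧-join nx (≤ᵇ-true u<x)) (none x))

    -- Induction on a bound `d` for the remaining gap between the keys: each step of `next` uses up
    -- at least one unit and does not pass `w`.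
    climb : ∀ d {u w} → N u ≡ true → N w ≡ true → key u ≤ key w → key w ≤ d + key u → ∃[ k ] iter next k u ≡ w
    climb d {u} {w} nu nw u≤w w≤ with m≤n⇒m<n∨m≡n u≤w
    climb d       nu nw u≤w w≤ | inj₂ eq = 0 , key-injective nu nw eq
    climb zero    nu nw u≤w w≤ | inj₁ u<w = ⊥-elim (<⇒≱ u<w w≤)
    climb (suc d) {u} {w} nu nw u≤w w≤ | inj₁ u<w with least (above u) key in eq
    ... | inj₂ none = ⊥-elim (true≢false (∧-join nw (≤ᵇ-true u<w)) (none w))
    ... | inj₁ (z , q , min) with ∧-split {N z} q
    ...   | nz , u<z with climb d nz nw (min w (∧-join nw (≤ᵇ-true u<w)))
                            (≤-trans w≤ (≤-trans (≤-reflexive (sym (+-suc d (key u)))) (+-monoʳ-≤ d (≤ᵇ-true⁻¹ u<z))))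
    ...     | k , p = suc k , trans (sym (iter-comm next k u)) (trans (cong (iter next k) step≡) p)
      where
      step≡ : next u ≡ z
      step≡ rewrite eq = refl

    -- Induction on a bound `d` for the distance to the largest key; from there one more step leads
    -- to the bottom element `b`.
    wrap : ∀ d {u b} → N u ≡ true → N b ≡ true → (∀ w → N w ≡ true → key b ≤ key w) →
      (∀ w → N w ≡ true → key w ≤ d + key u) → ∃[ k ] iter next k u ≡ b
    wrap d {u} {b} nu nb bot top with least (above u) key in eq
    ... | inj₂ none = 1 , last
      where
      last : next u ≡ b
      last rewrite eq with least N key
      ... | inj₁ (z , nz , min) = key-injective nz nb (≤-antisym (min b nb) (bot z nz))
      ... | inj₂ none′          = ⊥-elim (true≢false nb (none′ b))
    ... | inj₁ (z , q , _) with ∧-split {N z} q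
    wrap zero    nu nb bot top | inj₁ (z , q , _) | nz , u<z = ⊥-elim (<⇒≱ (≤ᵇ-true⁻¹ u<z) (top z nz))
    wrap (suc d) {u} nu nb bot top | inj₁ (z , q , _) | nz , u<z
      with wrap d nz nb bot (λ w nw → ≤-trans (top w nw)
             (≤-trans (≤-reflexive (sym (+-suc d (key u)))) (+-monoʳ-≤ d (≤ᵇ-true⁻¹ u<z))))
    ... | k , p = suc k , trans (sym (iter-comm next k u)) (trans (cong (iter next k) step≡) p)
      where
      step≡ : next u ≡ z
      step≡ rewrite eq = refl

    transitive : ∀ u w → N u ≡ true → N w ≡ true → ∃[ k ] iter next k u ≡ w
    transitive u w nu nw with least N key
    ... | inj₂ none = ⊥-elim (true≢false nu (none u))
    ... | inj₁ (b , nb , bot)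
      -- Go over the top to the bottom element, then climb to `w`. The sum of all keys is a crude
      -- bound on each of them.
      with wrap (sumFin key) nu nb bot (λ z _ → ≤-trans (sumFin-term key z) (m≤m+n _ _))
         | climb (key w) nb nw (bot w nw) (m≤m+n _ _)
    ...   | k , p | l , q = l + k , trans (iter-+ next l k u) (trans (cong (iter next l) p) q)

  -- Directed consecutive elements of a set

  -- A position read upwards for `true` and downwards for `false`; in both cases it is below `n`, so
  -- it can serve as the low digit of a key.
  offset : {n : ℕ} → Bool → Fin n → ℕ
  offset     true  u = toℕ u
  offset {n} false u = n ∸ suc (toℕ u)

  offset<n : {n : ℕ} (b : Bool) (u : Fin n) → offset b u < n
  offset<n true  u       = Fin.toℕ<n u
  offset<n {n} false u   = ∸-monoʳ-< {n} {suc (toℕ u)} {0} (s≤s z≤n) (Fin.toℕ<n u)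

  offset-flip : {n : ℕ} (b : Bool) {u z : Fin n} → offset b u < offset b z → offset (not b) z < offset (not b) u
  offset-flip true  {u} {z} u<z = ∸-monoʳ-< (s≤s u<z) (Fin.toℕ<n z)
  offset-flip {n} false {u} {z} u<z = ≰⇒> λ u≤z → <⇒≱ u<z (∸-monoʳ-≤ n (s≤s u≤z))

  offset-injective : {n : ℕ} (b : Bool) {u z : Fin n} → offset b u ≡ offset b z → u ≡ z
  offset-injective true  eq = Fin.toℕ-injective eq
  offset-injective false {u} {z} eq = Fin.toℕ-injective (suc-injective (∸-cancelˡ-≡ (Fin.toℕ<n u) (Fin.toℕ<n z) eq))

  -- The gap condition treats both ends alike, so reversing the direction merely exchanges `u` and
  -- `x`.
  Next : {n : ℕ} → (Fin n → Bool) → Bool → Fin n → Fin n → Set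
  Next S b u x = S u ≡ true × S x ≡ true × offset b u < offset b x
    × (∀ z → S z ≡ true → offset b u < offset b z → ¬ (offset b z < offset b x))

  Next-flip : {n : ℕ} {S : Fin n → Bool} (b : Bool) {u x : Fin n} → Next S b u x → Next S (not b) x u
  Next-flip b (su , sx , u<x , gap) = sx , su , offset-flip b u<x ,
    λ z sz x<z z<u → gap z sz (unflip b z<u) (unflip b x<z)
    where
    unflip : {n : ℕ} (b : Bool) {u z : Fin n} → offset (not b) u < offset (not b) z → offset b z < offset b u
    unflip true  = offset-flip false
    unflip false = offset-flip true

  Next-cong : {n : ℕ} {S S′ : Fin n → Bool} {b b′ : Bool} {u x : Fin n} →
    (∀ z → S z ≡ S′ z) → b ≡ b′ → Next S b u x → Next S′ b′ u x
  Next-cong {u = u} {x} eq refl (su , sx , u<x , gap) =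
    trans (sym (eq u)) su , trans (sym (eq x)) sx , u<x , λ z sz → gap z (trans (eq z) sz)

  -- Ranks and their parity.

  parity : ℕ → Bool
  parity zero    = false
  parity (suc k) = not (parity k)

  rank : {n : ℕ} → (Fin n → Bool) → Fin n → ℕ
  rank S x = count (λ z → S z ∧ (suc (toℕ z) ≤ᵇ toℕ x))

  rank-cong : {n : ℕ} {S S′ : Fin n → Bool} (x : Fin n) → (∀ z → S z ≡ S′ z) → rank S x ≡ rank S′ x
  rank-cong x eq = count-cong (λ z → cong (_∧ (suc (toℕ z) ≤ᵇ toℕ x)) (eq z))

  -- Below `x` lie `u` and what lies below `u`; the gap condition excludes anything in between.
  rank-next : {n : ℕ} (S : Fin n → Bool) {u x : Fin n} → Next S true u x → rank S x ≡ suc (rank S u)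
  rank-next {n} S {u} {x} (su , sx , u<x , gap) = begin
    rank S x                                          ≡⟨ count-sumFin (λ z → S z ∧ (suc (toℕ z) ≤ᵇ toℕ x)) ⟩
    sumFin (λ z → ⟦ S z ∧ (suc (toℕ z) ≤ᵇ toℕ x) ⟧)   ≡⟨ sumFin-cong pointwise ⟩
    sumFin (λ z → ⟦ is-u z ⟧ + ⟦ below z ⟧)           ≡⟨ sumFin-+ (λ z → ⟦ is-u z ⟧) (λ z → ⟦ below z ⟧) ⟩
    sumFin (λ z → ⟦ is-u z ⟧) + sumFin (λ z → ⟦ below z ⟧) ≡⟨ cong₂ _+_ single (sym (count-sumFin below)) ⟩
    suc (rank S u)                                    ∎
    where
    open ≡-Reasoning
    is-u below : Fin n → Bool
    is-u z = does (z Fin.≟ u)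
    below z = S z ∧ (suc (toℕ z) ≤ᵇ toℕ u)
    single : sumFin (λ z → ⟦ is-u z ⟧) ≡ 1
    single = ≤-antisym
      (≤-trans (≤-reflexive (sym (count-sumFin is-u)))
        (count-unique is-u (λ i j p q → trans (does⇒ (i Fin.≟ u) p) (sym (does⇒ (j Fin.≟ u) q)))))
      (≤-trans (≤-reflexive (sym (cong ⟦_⟧ (dec-true (u Fin.≟ u) refl)))) (sumFin-term (λ z → ⟦ is-u z ⟧) u))
    pointwise : ∀ z → ⟦ S z ∧ (suc (toℕ z) ≤ᵇ toℕ x) ⟧ ≡ ⟦ is-u z ⟧ + ⟦ below z ⟧
    pointwise z with z Fin.≟ u
    ... | yes refl rewrite su | ≤ᵇ-true u<x | dec-false (suc (toℕ z) ≤? toℕ z) 1+n≰n = refl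
    ... | no z≢u with S z in sz
    ...   | false = refl
    ...   | true with <-cmp (toℕ z) (toℕ u)
    ...     | tri< z<u _ _ rewrite ≤ᵇ-true z<u | ≤ᵇ-true (<-trans z<u u<x) = refl
    ...     | tri≈ _ eq _ = ⊥-elim (z≢u (Fin.toℕ-injective eq))
    ...     | tri> z≮u _ u<z rewrite dec-false (suc (toℕ z) ≤? toℕ u) z≮u
                                   | dec-false (suc (toℕ z) ≤? toℕ x) (gap z sz u<z) = refl

  -- A downward step is an upward step read backwards, so the rank changes by one in both
  -- directions.
  Next-parity : {n : ℕ} (S : Fin n → Bool) (b : Bool) {u x : Fin n} → Next S b u x →
    parity (rank S x) ≡ not (parity (rank S u))
  Next-parity S true  nx = cong parity (rank-next S nx)
  Next-parity S false {u} {x} nx =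
    sym (trans (cong (not ∘ parity) (rank-next S (Next-flip false nx))) (not-involutive _))

  -- The rotation system of a partition into bicliques.

  *n+-mono : ∀ {n a b o} p → o < n → a < b → a * n + o < b * n + p
  *n+-mono {n} {a} {b} {o} p o<n a<b = begin-strict
    a * n + o  <⟨ +-monoʳ-< (a * n) o<n ⟩
    a * n + n  ≡⟨ +-comm (a * n) n ⟩
    suc a * n  ≤⟨ *-monoˡ-≤ n a<b ⟩
    b * n      ≤⟨ m≤m+n (b * n) p ⟩
    b * n + p  ∎
    where open ≤-Reasoning

  -- κ v labels the edges at v; the labels are the traces of a partition of the edges into bicliques.
  module Bicliques {n : ℕ} (G : Graph n) (κ : Fin n → Fin n → ℕ)
    (biclique : ∀ {v u x y} → adj G v u ≡ true → adj G v x ≡ true → κ v x ≡ κ v u →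
       adj G u y ≡ true → κ u y ≡ κ u v → adj G x y ≡ true × κ x y ≡ κ x v)
    (B : ℕ) (κ<B : ∀ v u → κ v u < B) where

    -- The side containing `u` of the biclique through the edge `v u`, as seen from `v`.
    class : Fin n → Fin n → Fin n → Bool
    class v u x = adj G v x ∧ does (κ v x ≟ κ v u)

    class-in : ∀ {v u x} → adj G v x ≡ true → κ v x ≡ κ v u → class v u x ≡ true
    class-in {v} {u} {x} a eq = ∧-join a (dec-true (κ v x ≟ κ v u) eq)

    class-out : ∀ {v u x} → class v u x ≡ true → adj G v x ≡ true × κ v x ≡ κ v u
    class-out {v} {u} {x} p = let a , d = ∧-split {adj G v x} p in a , does⇒ (κ v x ≟ κ v u) d

    class-same : ∀ {v u x} → class v u x ≡ true → ∀ y → class v x y ≡ class v u y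
    class-same {v} p y rewrite proj₂ (class-out {v} p) = refl

    -- The side of `v` looks the same from every vertex of the opposite side; `biclique` gives the
    -- two inclusions.
    class-opposite : ∀ {v u x} → adj G v u ≡ true → class v u x ≡ true → ∀ y → class x v y ≡ class u v y
    class-opposite {v} {u} {x} a p y = iff⇒≡ (transfer ax a (sym eq)) (transfer a ax eq)
      where
      ax = proj₁ (class-out {v} {u} {x} p)
      eq = proj₂ (class-out {v} {u} {x} p)
      transfer : ∀ {s t} → adj G v s ≡ true → adj G v t ≡ true → κ v t ≡ κ v s →
        class s v y ≡ true → class t v y ≡ true
      transfer {s} {t} as at e q =
        let ay , ey = class-out {s} {v} {y} q ; bt , et = biclique as at e ay ey in class-in bt et

    -- The direction in which `v` traverses the side of `u`; it alternates with the position of `v`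
    -- in its own side.
    dir : Fin n → Fin n → Bool
    dir v u = parity (rank (class u v) v)

    dir-same : ∀ {v u x} → adj G v u ≡ true → class v u x ≡ true → dir v x ≡ dir v u
    dir-same {v} a p = cong parity (rank-cong v (class-opposite a p))

    -- With the label as leading digit, each biclique occupies an interval of the order at `v`; the
    -- low digit orders that interval in the direction `dir`.
    key : Fin n → Fin n → ℕ
    key v u = κ v u * n + offset (dir v u) u

    key-injective : ∀ v {u w} → adj G v u ≡ true → adj G v w ≡ true → key v u ≡ key v w → u ≡ w
    key-injective v {u} {w} au aw eq with <-cmp (κ v u) (κ v w)
    ... | tri< lt _ _ = ⊥-elim (<⇒≢ (*n+-mono _ (offset<n (dir v u) u) lt) eq)
    ... | tri> _ _ gt = ⊥-elim (<⇒≢ (*n+-mono _ (offset<n (dir v w) w) gt) (sym eq))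
    ... | tri≈ _ κ≡ _ = offset-injective (dir v u) (+-cancelˡ-≡ (κ v u * n) _ _
          (trans eq (cong₂ (λ k b → k * n + offset b w) (sym κ≡) (dir-same au (class-in aw (sym κ≡))))))

    module C (v : Fin n) = Cyclic (adj G v) (key v) (key-injective v)

    ρ : Fin n → Fin n → Fin n
    ρ v = C.next v

    ρ-rotation : IsRotationSystem G ρ
    ρ-rotation v = (λ u → C.next-closed v) , C.transitive v

    key-same : ∀ {v u z} → adj G v u ≡ true → class v u z ≡ true → key v z ≡ κ v u * n + offset (dir v u) z
    key-same {v} {u} {z} a p = cong₂ (λ k b → k * n + offset b z) (proj₂ (class-out {v} {u} {z} p)) (dir-same a p)

    -- Neighbours with other labels come before or after the whole class, so only the order inside
    -- the class matters.
    Next⇒ρ : ∀ {v u x} → adj G v u ≡ true → Next (class v u) (dir v u) u x → ρ v u ≡ x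
    Next⇒ρ {v} {u} {x} a (_ , sx , u<x , gap) =
      C.next-unique v (proj₁ (class-out sx)) (<-≤-trans (+-monoʳ-< (κ v u * n) u<x) (≤-reflexive (sym kx))) min
      where
      kx = key-same a sx
      min : ∀ z → adj G v z ≡ true → key v u < key v z → key v x ≤ key v z
      min z az ku<kz with <-cmp (κ v z) (κ v u)
      ... | tri< lt _ _ = ⊥-elim (<-asym ku<kz (*n+-mono _ (offset<n (dir v z) z) lt))
      ... | tri> _ _ gt = ≤-trans (≤-reflexive kx) (<⇒≤ (*n+-mono _ (offset<n (dir v u) x) gt))
      ... | tri≈ _ eq _ = subst₂ _≤_ (sym kx) (sym kz) (+-monoʳ-≤ (κ v u * n) (≮⇒≥ (gap z sz
              (+-cancelˡ-< (κ v u * n) _ _ (<-≤-trans ku<kz (≤-reflexive kz))))))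
        where
        sz = class-in az eq
        kz = key-same a sz

    -- The quadrilateral is u v x w: x follows u at v and w follows v at x; then passing to the neighbouring
    -- row or column reverses the direction, so u follows x at w and v follows w at u.
    closes-up : ∀ {u v x w} → adj G u v ≡ true →
      Next (class v u) (dir v u) u x → Next (class x v) (dir x v) v w →
      iter (faceStep G ρ) 4 (u , v) ≡ (u , v)
    closes-up {u} {v} {x} {w} auv nx nw =
      turn (turn (turn (turn refl (Next⇒ρ avu nx)) (Next⇒ρ axv nw)) (Next⇒ρ awx nu)) (Next⇒ρ auw nv)
      where
      turn : ∀ {D s t z} → D ≡ (s , t) → ρ t s ≡ z → faceStep G ρ D ≡ (t , z)
      turn refl refl = refl
      avu = IsDart-sym G {u} {v} auv
      sx  = proj₁ (proj₂ nx)
      sw  = proj₁ (proj₂ nw)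
      avx = proj₁ (class-out {v} {u} {x} sx)
      axv = IsDart-sym G {v} {x} avx
      axw = proj₁ (class-out {x} {v} {w} sw)
      awx = IsDart-sym G {x} {w} axw
      rows : ∀ y → class w x y ≡ class v u y
      rows y = trans (class-opposite axv sw y) (class-same {v} {u} {x} sx y)
      -- `v` and `w` are consecutive in their side, so their ranks have opposite parity and `w`
      -- reads the side of `u` backwards.
      dir-wx : dir w x ≡ not (dir v u)
      dir-wx = trans (cong parity (rank-cong w (class-same {x} {v} {w} sw)))
        (trans (Next-parity (class x v) (dir x v) nw) (cong (not ∘ parity) (rank-cong v (class-opposite avu sx))))
      nu : Next (class w x) (dir w x) x u
      nu = Next-cong (λ y → sym (rows y)) (sym dir-wx) (Next-flip (dir v u) nx)
      su  = proj₁ (proj₂ nu)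
      auw = IsDart-sym G {w} {u} (proj₁ (class-out {w} {x} {u} su))
      dir-xv : dir x v ≡ not (dir u v)
      dir-xv = trans (cong parity (rank-cong x (class-same {v} {u} {x} sx))) (Next-parity (class v u) (dir v u) nx)
      -- `u` has the same rank seen from `w` as from `v`, while the rank of `x` has the opposite
      -- parity.
      dir-uw : dir u w ≡ not (dir x v)
      dir-uw = trans (cong parity (rank-cong u (λ y → trans (class-same {w} {x} {u} su y) (rows y))))
        (sym (trans (cong not dir-xv) (not-involutive _)))
      nv : Next (class u w) (dir u w) w v
      nv = Next-cong (λ y → sym (trans (class-opposite awx su y) (class-same {x} {v} {w} sw y)))
        (sym dir-uw) (Next-flip (dir x v) nw)

    after : Fin n → Fin n → Fin n → Bool
    after v u z = class v u z ∧ (suc (offset (dir v u) u) ≤ᵇ offset (dir v u) z)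

    isLast : Fin n → Fin n → Bool
    isLast v u with least (after v u) (offset (dir v u))
    ... | inj₁ _ = false
    ... | inj₂ _ = true

    next-or-last : ∀ {v u} → adj G v u ≡ true → isLast v u ≡ false → ∃[ x ] Next (class v u) (dir v u) u x
    next-or-last {v} {u} a p with least (after v u) (offset (dir v u))
    ... | inj₁ (x , q , min) = let cx , u<x = ∧-split {class v u x} q in
      x , class-in a refl , cx , ≤ᵇ-true⁻¹ u<x ,
      λ z cz u<z z<x → <⇒≱ z<x (min z (∧-join cz (≤ᵇ-true u<z)))

    isLast-none : ∀ {v u} → isLast v u ≡ true → ∀ z → after v u z ≡ false
    isLast-none {v} {u} p with least (after v u) (offset (dir v u))
    ... | inj₂ none = none

    isLast-unique : ∀ v i j → adj G v i ∧ isLast v i ≡ true → adj G v j ∧ isLast v j ≡ true → κ v i ≡ κ v j → i ≡ j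
    isLast-unique v i j p q eq with ∧-split {adj G v i} p | ∧-split {adj G v j} q
    ... | ai , li | aj , lj = offset-injective (dir v i) (≤-antisym
        (≮⇒≥ λ j<i → true≢false (∧-join (class-in ai eq) (≤ᵇ-true (subst (λ b → offset b j < offset b i) (sym dir≡) j<i)))
          (isLast-none {v} {j} lj i))
        (≮⇒≥ λ i<j → true≢false (∧-join cj (≤ᵇ-true i<j)) (isLast-none {v} {i} li j)))
      where
      cj = class-in {v} {i} aj (sym eq)
      dir≡ = dir-same ai cj

    -- Darts entering `v` from the last vertex of a class, where the rotation has no later vertex of
    -- that class to turn to.
    bad : Dart G → Bool
    bad (u , v) = isLast v u

    -- Each vertex has at most one last neighbour per label, and the labels are below `B`.
    dartSum-bad : dartSum G (⟦_⟧ ∘ bad) ≤ n * B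
    dartSum-bad = begin
      dartSum G (⟦_⟧ ∘ bad)                         ≡⟨ sumFin-swap (λ u v → if adj G u v then ⟦ isLast v u ⟧ else 0) ⟩
      sumFin (λ v → sumFin (λ u → if adj G u v then ⟦ isLast v u ⟧ else 0))
        ≡⟨ sumFin-cong (λ v → sumFin-cong (pointwise v)) ⟩
      sumFin (λ v → sumFin (λ u → ⟦ last v u ⟧))    ≤⟨ sumFin-≤ (λ v → ≤-trans (≤-reflexive (sym (count-sumFin (last v))))
                                                        (count-injective (last v) (κ v) B (κ<B v) (isLast-unique v))) ⟩
      n * B                                         ∎
      where
      open ≤-Reasoning
      last : Fin n → Fin n → Bool
      last v u = adj G v u ∧ isLast v u
      pointwise : ∀ v u → (if adj G u v then ⟦ isLast v u ⟧ else 0) ≡ ⟦ last v u ⟧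
      pointwise v u rewrite Graph.sym G u v with adj G v u
      ... | true  = refl
      ... | false = refl

    many-faces : 2 * eG G ≤ 4 * faces G ρ + 2 * (n * B)
    many-faces = ≤-trans (faces-lower G ρ ρ-rotation bad closes)
      (+-monoʳ-≤ (4 * faces G ρ) (*-monoʳ-≤ 2 dartSum-bad))
      where
      closes : ∀ {D} → IsDart G D → bad D ≡ false → bad (faceStep G ρ D) ≡ false → iter (faceStep G ρ) 4 D ≡ D
      -- A dart that is not bad moves on to a vertex `x` of its class. Its successor is then the
      -- dart from `v` to `x`, for which the second hypothesis provides `w`.
      closes {u , v} a b₀ b₁ =
        let avu    = IsDart-sym G {u} {v} a
            x , nx = next-or-last avu b₀
            axv    = IsDart-sym G {v} {x} (proj₁ (class-out {v} {u} {x} (proj₁ (proj₂ nx))))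
            w , nw = next-or-last axv (subst (λ z → isLast z v ≡ false) (Next⇒ρ avu nx) b₁)
        in closes-up a nx nw

  -- Bicliques from traces on chunks.

  code : ℕ → (ℕ → Bool) → ℕ
  code zero    f = 0
  code (suc s) f = ⟦ f 0 ⟧ + 2 * code s (f ∘ suc)

  code<2^ : ∀ s f → code s f < 2 ^ s
  code<2^ zero    f = s≤s z≤n
  code<2^ (suc s) f = begin-strict
    ⟦ f 0 ⟧ + 2 * c  <⟨ s≤s (+-monoˡ-≤ (2 * c) (⟦⟧≤1 (f 0))) ⟩
    2 + 2 * c        ≡⟨ *-suc 2 c ⟨
    2 * suc c        ≤⟨ *-monoʳ-≤ 2 (code<2^ s (f ∘ suc)) ⟩
    2 * 2 ^ s        ∎
    where
    open ≤-Reasoning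
    c = code s (f ∘ suc)

  bit-injective : ∀ a b x y → ⟦ a ⟧ + 2 * x ≡ ⟦ b ⟧ + 2 * y → a ≡ b × x ≡ y
  bit-injective true  true  x y e = refl , *-cancelˡ-≡ x y 2 (+-cancelˡ-≡ 1 _ _ e)
  bit-injective false false x y e = refl , *-cancelˡ-≡ x y 2 e
  bit-injective true  false x y e = ⊥-elim (even≢odd y x (sym e))
  bit-injective false true  x y e = ⊥-elim (even≢odd x y e)

  code-injective : ∀ s f g → code s f ≡ code s g → ∀ {i} → i < s → f i ≡ g i
  code-injective (suc s) f g eq {zero} _ =
    proj₁ (bit-injective (f 0) (g 0) (code s (f ∘ suc)) (code s (g ∘ suc)) eq)
  code-injective (suc s) f g eq {suc i} i<s = code-injective s (f ∘ suc) (g ∘ suc)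
    (proj₂ (bit-injective (f 0) (g 0) (code s (f ∘ suc)) (code s (g ∘ suc)) eq)) (s≤s⁻¹ i<s)

  -- Cut V₁ into chunks of s consecutive vertices. The vertices of V₂ with the same neighbours in a given chunk
  -- form, together with these neighbours, a biclique.
  module Chunks {n : ℕ} (G : Graph n) (V₁ : Subset n) (bip : IsBipartition G V₁) (s : ℕ) .{{_ : NonZero s}} where

    -- The value `false` beyond the last vertex lets an incomplete final chunk be encoded like the
    -- others.
    adjℕ : Fin n → ℕ → Bool
    adjℕ v m with m <? n
    ... | yes m<n = adj G v (fromℕ< m<n)
    ... | no  _   = false

    adjℕ-toℕ : ∀ v x → adjℕ v (toℕ x) ≡ adj G v x
    adjℕ-toℕ v x with toℕ x <? n
    ... | yes p = cong (adj G v) (Fin.fromℕ<-toℕ x p)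
    ... | no ¬p = contradiction (Fin.toℕ<n x) ¬p

    -- The set of neighbours of `u` in chunk number `c`, as a binary number below 2 ^ s.
    trace : ℕ → Fin n → ℕ
    trace c u = code s (λ i → adjℕ u (i + c * s))

    -- The remainder modulo `s` is the position of `y` in its chunk, and equal codes agree in that
    -- bit.
    trace-adj : ∀ {c u x} y → toℕ y / s ≡ c → trace c u ≡ trace c x → adj G u y ≡ true → adj G x y ≡ true
    trace-adj {c} {u} {x} y refl eq a = begin
      adj G x y                 ≡⟨ adjℕ-toℕ x y ⟨
      adjℕ x (toℕ y)            ≡⟨ cong (adjℕ x) pos ⟩
      adjℕ x (toℕ y % s + c * s) ≡⟨ code-injective s _ _ eq (m%n<n (toℕ y) s) ⟨
      adjℕ u (toℕ y % s + c * s) ≡⟨ cong (adjℕ u) pos ⟨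
      adjℕ u (toℕ y)            ≡⟨ adjℕ-toℕ u y ⟩
      adj G u y                 ≡⟨ a ⟩
      true                      ∎
      where
      open ≡-Reasoning
      pos = m≡m%n+[m/n]*n (toℕ y) s

    -- A biclique is given by a chunk and a trace on it. A vertex of `V₁` determines the chunk and
    -- records the trace of its neighbour; a vertex of `V₂` determines the trace on any chunk and
    -- records the chunk.
    κ : Fin n → Fin n → ℕ
    κ v u = if lookup V₁ v then trace (toℕ v / s) u else toℕ u / s

    κ-V₁ : ∀ {v} → lookup V₁ v ≡ true → ∀ u → κ v u ≡ trace (toℕ v / s) u
    κ-V₁ e u rewrite e = refl

    κ-V₂ : ∀ {v} → lookup V₁ v ≡ false → ∀ u → κ v u ≡ toℕ u / s
    κ-V₂ e u rewrite e = refl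

    opposite : ∀ {v u b} → adj G v u ≡ true → lookup V₁ v ≡ b → lookup V₁ u ≡ not b
    opposite {v} {u} a e = trans (bip u v (IsDart-sym G a)) (cong not e)

    biclique : ∀ {v u x y} → adj G v u ≡ true → adj G v x ≡ true → κ v x ≡ κ v u →
       adj G u y ≡ true → κ u y ≡ κ u v → adj G x y ≡ true × κ x y ≡ κ x v
    biclique {v} {u} {x} {y} avu avx κxu auy κyv with lookup V₁ v in side
    -- `u` and `x` have the same trace on the chunk of `v`, which also contains `y`.
    ... | true = trace-adj y chunk (sym κxu) auy
               , trans (κ-V₂ x∈V₂ y) (trans chunk (sym (κ-V₂ x∈V₂ v)))
      where
      x∈V₂ = opposite avx side
      chunk : toℕ y / s ≡ toℕ v / s
      chunk = trans (sym (κ-V₂ (opposite avu side) y)) (trans κyv (κ-V₂ (opposite avu side) v))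
    -- `u` and `x` lie in one chunk, on which `y` and `v` have the same trace.
    ... | false = IsDart-sym G (trace-adj x refl (sym traces) avx)
                , trans (κ-V₁ x∈V₁ y) (trans traces (sym (κ-V₁ x∈V₁ v)))
      where
      x∈V₁ = opposite avx side
      u∈V₁ = opposite avu side
      traces : trace (toℕ x / s) y ≡ trace (toℕ x / s) v
      traces rewrite κxu = trans (sym (κ-V₁ u∈V₁ y)) (trans κyv (κ-V₁ u∈V₁ v))

    B : ℕ
    B = 2 ^ s + suc (n / s)

    κ<B : ∀ v u → κ v u < B
    κ<B v u with lookup V₁ v
    ... | true  = <-≤-trans (code<2^ s _) (m≤m+n _ _)
    ... | false = ≤-trans (s≤s (/-monoˡ-≤ s (<⇒≤ (Fin.toℕ<n u)))) (m≤n+m _ _)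

    open Bicliques G κ biclique B κ<B public

  -- Genus bounds from Euler's formula.

  module _ {n : ℕ} (G : Graph n) (V₁ : Subset n) (bip : IsBipartition G V₁) where

    -- The components are dropped, the isolated vertices are at most `n`, and `faces-upper` limits
    -- the faces. Rounding in the division by 2 loses at most one, which accounts for the constant
    -- 2.
    genus-lower : ∀ {g} → IsGenus G g → eG G ≤ 4 * g + (6 * n + 2)
    genus-lower {g} ((ρ , rot , refl) , _) = *-cancelˡ-≤ 2 (+-cancelʳ-≤ (2 * e) _ _ doubled)
      where
      e = eG G
      F = faces G ρ
      X = 2 * components G + e ∸ (n + (F + isolated G))
      X≤ : X ≤ 1 + 2 * (X / 2)
      X≤ = begin
        X                   ≡⟨ m≡m%n+[m/n]*n X 2 ⟩
        X % 2 + X / 2 * 2   ≤⟨ +-mono-≤ (s≤s⁻¹ (m%n<n X 2)) (≤-reflexive (*-comm (X / 2) 2)) ⟩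
        1 + 2 * (X / 2)     ∎
        where open ≤-Reasoning
      e≤ : e ≤ n + (F + n) + (1 + 2 * (X / 2))
      e≤ = begin
        e                                       ≤⟨ m≤n+m e (2 * components G) ⟩
        2 * components G + e                    ≤⟨ m≤n+m∸n (2 * components G + e) (n + (F + isolated G)) ⟩
        n + (F + isolated G) + X                ≤⟨ +-mono-≤ (+-monoʳ-≤ n (+-monoʳ-≤ F (count≤n _))) X≤ ⟩
        n + (F + n) + (1 + 2 * (X / 2))         ∎
        where open ≤-Reasoning
      doubled : 2 * e + 2 * e ≤ 2 * (4 * (X / 2) + (6 * n + 2)) + 2 * e
      doubled = begin
        2 * e + 2 * e                             ≡⟨ arith₁ e ⟩
        4 * e                                     ≤⟨ *-monoʳ-≤ 4 e≤ ⟩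
        4 * (n + (F + n) + (1 + 2 * (X / 2)))     ≡⟨ arith₂ n F (X / 2) ⟩
        4 * F + (8 * n + 4 + 8 * (X / 2))         ≤⟨ +-monoˡ-≤ _ (faces-upper G ρ rot V₁ bip) ⟩
        2 * e + 4 * n + (8 * n + 4 + 8 * (X / 2)) ≡⟨ arith₃ e n (X / 2) ⟩
        2 * (4 * (X / 2) + (6 * n + 2)) + 2 * e   ∎
        where
        open ≤-Reasoning
        arith₁ : ∀ e → 2 * e + 2 * e ≡ 4 * e
        arith₁ = solve-∀
        arith₂ : ∀ n F h → 4 * (n + (F + n) + (1 + 2 * h)) ≡ 4 * F + (8 * n + 4 + 8 * h)
        arith₂ = solve-∀
        arith₃ : ∀ e n h → 2 * e + 4 * n + (8 * n + 4 + 8 * h) ≡ 2 * (4 * h + (6 * n + 2)) + 2 * e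
        arith₃ = solve-∀

    -- Minimality of `g` is applied to the rotation system of the bicliques. The components are at
    -- most `n`, and subtracting only the faces enlarges the estimate.
    genus-upper : ∀ s .{{_ : NonZero s}} {g} → IsGenus G g →
      4 * g ≤ eG G + (4 * n + n * (2 ^ s + suc (n / s)))
    genus-upper s {g} (_ , minimal) = begin
      4 * g                                    ≤⟨ *-monoʳ-≤ 4 (minimal ρ ρ-rotation) ⟩
      4 * (X / 2)                              ≡⟨ arith₁ (X / 2) ⟩
      2 * (X / 2 * 2)                          ≤⟨ *-monoʳ-≤ 2 (m/n*n≤m X 2) ⟩
      2 * X                                    ≤⟨ *-monoʳ-≤ 2 X≤ ⟩
      2 * (2 * n + e ∸ F)                      ≡⟨ *-distribˡ-∸ 2 (2 * n + e) F ⟩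
      2 * (2 * n + e) ∸ 2 * F                  ≤⟨ m≤n+o⇒m∸n≤o (2 * (2 * n + e)) (2 * F) bound ⟩
      e + (4 * n + n * B)                      ∎
      where
      open Chunks G V₁ bip s
      open ≤-Reasoning
      e = eG G
      F = faces G ρ
      X = 2 * components G + e ∸ (n + (F + isolated G))
      X≤ : X ≤ 2 * n + e ∸ F
      X≤ = ∸-mono (+-monoˡ-≤ e (*-monoʳ-≤ 2 {components G} {n} (count≤n _))) (≤-trans (m≤m+n F (isolated G)) (m≤n+m _ n))
      arith₁ : ∀ h → 4 * h ≡ 2 * (h * 2)
      arith₁ = solve-∀
      e≤ : e ≤ 2 * F + n * B
      e≤ = *-cancelˡ-≤ 2 (≤-trans many-faces (≤-reflexive (arith₂ F (n * B))))
        where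
        arith₂ : ∀ F m → 4 * F + 2 * m ≡ 2 * (2 * F + m)
        arith₂ = solve-∀
      bound : 2 * (2 * n + e) ≤ 2 * F + (e + (4 * n + n * B))
      bound = begin
        2 * (2 * n + e)                   ≡⟨ arith₃ n e ⟩
        e + (e + 4 * n)                   ≤⟨ +-monoˡ-≤ (e + 4 * n) e≤ ⟩
        2 * F + n * B + (e + 4 * n)       ≡⟨ arith₄ F (n * B) e n ⟩
        2 * F + (e + (4 * n + n * B))     ∎
        where
        arith₃ : ∀ n e → 2 * (2 * n + e) ≡ e + (e + 4 * n)
        arith₃ = solve-∀
        arith₄ : ∀ F m e n → 2 * F + m + (e + 4 * n) ≡ 2 * F + (e + (4 * n + m))
        arith₄ = solve-∀

  -- The choice of the constants.

  module _ (k : ℕ) where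

    private
      K = suc k
      -- `K` is to be the denominator of ε. If `n * n` is at most about `K * e`, the error n²/s is
      -- at most about e/K, hence at most about ε e.
      s = K * K

    -- The product makes the error terms linear in `n` at most n² even after multiplication by `s`;
    -- the summand 2 gives n ≥ 2.
    threshold : ℕ
    threshold = s * (8 + 2 ^ s) + 2

    module _ {n e : ℕ} (large : threshold ≤ n) (dense : n * n ≤ K * e + 1) where

      private
        sn≤ : s * (8 + 2 ^ s) * n ≤ n * n
        sn≤ = *-monoˡ-≤ n (≤-trans (m≤m+n _ 2) large)

        2≤n : 2 ≤ n
        2≤n = ≤-trans (m≤n+m 2 (s * (8 + 2 ^ s))) large

        2nn≤ : 2 * (n * n) ≤ K * (10 * e)
        2nn≤ = begin
          2 * (n * n)        ≤⟨ *-monoʳ-≤ 2 dense ⟩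
          2 * (K * e + 1)    ≤⟨ *-monoʳ-≤ 2 (+-monoʳ-≤ (K * e) 1≤) ⟩
          2 * (K * e + K * e) ≡⟨ arith (K * e) ⟩
          4 * (K * e)        ≤⟨ *-monoˡ-≤ (K * e) (m≤m+n 4 6) ⟩
          10 * (K * e)       ≡⟨ arith′ K e ⟩
          K * (10 * e)       ∎
          where
          open ≤-Reasoning
          -- As n ≥ 2, `dense` cannot hold with `K * e` equal to zero; so the additive 1 in `dense`
          -- is absorbed.
          1≤ : 1 ≤ K * e
          1≤ = s≤s⁻¹ (≤-trans (≤-trans (s≤s (s≤s z≤n)) (*-mono-≤ 2≤n 2≤n)) (≤-trans dense (≤-reflexive (+-comm (K * e) 1))))
          arith : ∀ x → 2 * (x + x) ≡ 4 * x
          arith = solve-∀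
          arith′ : ∀ x y → 10 * (x * y) ≡ x * (10 * y)
          arith′ = solve-∀

      lower-error : K * (6 * n + 2) ≤ 10 * e
      lower-error = *-cancelˡ-≤ K (begin
        K * (K * (6 * n + 2))      ≡⟨ *-assoc K K _ ⟨
        s * (6 * n + 2)            ≤⟨ *-monoʳ-≤ s (+-monoʳ-≤ (6 * n) 2≤n) ⟩
        s * (6 * n + n)            ≡⟨ arith s n ⟩
        s * 7 * n                  ≤⟨ *-monoˡ-≤ n (*-monoʳ-≤ s (≤-trans (m≤n+m 7 1) (m≤m+n 8 (2 ^ s)))) ⟩
        s * (8 + 2 ^ s) * n        ≤⟨ sn≤ ⟩
        n * n                      ≤⟨ m≤m+n _ _ ⟩
        2 * (n * n)                ≤⟨ 2nn≤ ⟩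
        K * (10 * e)               ∎)
        where
        open ≤-Reasoning
        arith : ∀ s n → s * (6 * n + n) ≡ s * 7 * n
        arith = solve-∀

      -- Multiplying by `K` once more produces the factor `s`. The part linear in `n` is then at
      -- most n² by the threshold, and so is the chunk term since n / s * s ≤ n.
      upper-error : K * (4 * n + n * (2 ^ s + suc (n / s))) ≤ 10 * e
      upper-error = *-cancelˡ-≤ K (begin
        K * (K * (4 * n + n * (2 ^ s + suc (n / s))))   ≡⟨ *-assoc K K _ ⟨
        s * (4 * n + n * (2 ^ s + suc (n / s)))         ≡⟨ arith s n (2 ^ s) (n / s) ⟩
        s * (5 + 2 ^ s) * n + n / s * s * n
          ≤⟨ +-mono-≤ (*-monoˡ-≤ n (*-monoʳ-≤ s (+-monoˡ-≤ (2 ^ s) (m≤n+m 5 3)))) (*-monoˡ-≤ n (m/n*n≤m n s)) ⟩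
        s * (8 + 2 ^ s) * n + n * n                     ≤⟨ +-monoˡ-≤ (n * n) sn≤ ⟩
        n * n + n * n                                   ≡⟨ cong (n * n +_) (+-identityʳ (n * n)) ⟨
        2 * (n * n)                                     ≤⟨ 2nn≤ ⟩
        K * (10 * e)                                    ∎)
        where
        open ≤-Reasoning
        arith : ∀ s n p q → s * (4 * n + n * (p + suc q)) ≡ s * (5 + p) * n + q * s * n
        arith = solve-∀

    -- The factor `K` keeps the relative error 10 / K within the natural numbers.
    genus-bounds : {n : ℕ} (G : Graph n) (V₁ : Subset n) → IsBipartition G V₁ →
      threshold ≤ n → n * n ≤ K * eG G + 1 → ∀ {g} → IsGenus G g →
      K * eG G ≤ K * (4 * g) + 10 * eG G × K * (4 * g) ≤ K * eG G + 10 * eG G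
    genus-bounds {n} G V₁ bip large dense {g} isg =
      ≤-trans (*-monoʳ-≤ K (genus-lower G V₁ bip isg))
        (≤-trans (≤-reflexive (*-distribˡ-+ K (4 * g) _)) (+-monoʳ-≤ (K * (4 * g)) (lower-error {n} large dense))) ,
      ≤-trans (*-monoʳ-≤ K (genus-upper G V₁ bip s isg))
        (≤-trans (≤-reflexive (*-distribˡ-+ K (eG G) _)) (+-monoʳ-≤ (K * eG G) (upper-error {n} large dense)))

open Combinatorics using (⟦_⟧; sumFin-cong; sumFin-mono; sumFin-+; sumFin-swap; count-sumFin;
  dartSum; dartSum-1; threshold; genus-bounds)

open import Data.Integer using (+_)
open import Data.Rational using (ℚ; 0ℚ; 1ℚ; _/_; _<_; _*_; _-_; _+_; mkℚ; toℚᵘ; -_; ↧ₙ_; Positive; NonNegative)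
import Data.Rational as Q
import Data.Rational.Properties as Qₚ
open import Data.Rational.Solver using (module +-*-Solver)
import Data.Rational.Unnormalised as U
import Data.Rational.Unnormalised.Properties as Uₚ

-- Natural numbers as rationals

toℚᵘ-/ : ∀ a m → toℚᵘ ((+ a) / N.suc m) U.≃ U.mkℚᵘ (+ a) m
toℚᵘ-/ a m = Qₚ.toℚᵘ-fromℚᵘ (U.mkℚᵘ (+ a) m)

/-*-cancel : ∀ a m → ((+ a) / N.suc m) * ℕ→ℚ (N.suc m) ≡ ℕ→ℚ a
/-*-cancel a m = Qₚ.toℚᵘ-injective (begin-equality
  toℚᵘ (((+ a) / N.suc m) * ℕ→ℚ (N.suc m))                ≃⟨ Qₚ.toℚᵘ-homo-* ((+ a) / N.suc m) (ℕ→ℚ (N.suc m)) ⟩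
  toℚᵘ ((+ a) / N.suc m) U.* toℚᵘ (ℕ→ℚ (N.suc m))         ≃⟨ Uₚ.*-cong (toℚᵘ-/ a m) (toℚᵘ-/ (N.suc m) 0) ⟩
  U.mkℚᵘ (+ a) m U.* U.mkℚᵘ (+ N.suc m) 0
    ≃⟨ U.*≡* (trans (ℤₚ.*-identityʳ _) (cong (λ k → + a ℤ.* + N.suc k) (sym (Nₚ.*-identityʳ m)))) ⟩
  U.mkℚᵘ (+ a) 0                                          ≃⟨ toℚᵘ-/ a 0 ⟨
  toℚᵘ (ℕ→ℚ a)                                            ∎)
  where open Uₚ.≤-Reasoning

ℕ→ℚ-* : ∀ a b → ℕ→ℚ (a N.* b) ≡ ℕ→ℚ a * ℕ→ℚ b
ℕ→ℚ-* a b = Qₚ.toℚᵘ-injective (begin-equality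
  toℚᵘ (ℕ→ℚ (a N.* b))                  ≃⟨ toℚᵘ-/ (a N.* b) 0 ⟩
  U.mkℚᵘ (+ (a N.* b)) 0                ≃⟨ U.*≡* (cong (ℤ._* + 1) (ℤₚ.pos-* a b)) ⟩
  U.mkℚᵘ (+ a) 0 U.* U.mkℚᵘ (+ b) 0     ≃⟨ Uₚ.*-cong (toℚᵘ-/ a 0) (toℚᵘ-/ b 0) ⟨
  toℚᵘ (ℕ→ℚ a) U.* toℚᵘ (ℕ→ℚ b)         ≃⟨ Qₚ.toℚᵘ-homo-* (ℕ→ℚ a) (ℕ→ℚ b) ⟨
  toℚᵘ (ℕ→ℚ a * ℕ→ℚ b)                  ∎)
  where open Uₚ.≤-Reasoning

ℕ→ℚ-+ : ∀ a b → ℕ→ℚ (a N.+ b) ≡ ℕ→ℚ a + ℕ→ℚ b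
ℕ→ℚ-+ a b = Qₚ.toℚᵘ-injective (begin-equality
  toℚᵘ (ℕ→ℚ (a N.+ b))                  ≃⟨ toℚᵘ-/ (a N.+ b) 0 ⟩
  U.mkℚᵘ (+ (a N.+ b)) 0
    ≃⟨ U.*≡* (cong (ℤ._* + 1) (cong₂ ℤ._+_ (sym (ℤₚ.*-identityʳ (+ a))) (sym (ℤₚ.*-identityʳ (+ b))))) ⟩
  U.mkℚᵘ (+ a) 0 U.+ U.mkℚᵘ (+ b) 0     ≃⟨ Uₚ.+-cong (toℚᵘ-/ a 0) (toℚᵘ-/ b 0) ⟨
  toℚᵘ (ℕ→ℚ a) U.+ toℚᵘ (ℕ→ℚ b)         ≃⟨ Qₚ.toℚᵘ-homo-+ (ℕ→ℚ a) (ℕ→ℚ b) ⟨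
  toℚᵘ (ℕ→ℚ a + ℕ→ℚ b)                  ∎)
  where open Uₚ.≤-Reasoning

ℕ→ℚ-mono : ∀ {a b} → a ≤ b → ℕ→ℚ a Q.≤ ℕ→ℚ b
ℕ→ℚ-mono {a} {b} a≤b = Qₚ.toℚᵘ-cancel-≤ (begin
  toℚᵘ (ℕ→ℚ a)     ≃⟨ toℚᵘ-/ a 0 ⟩
  U.mkℚᵘ (+ a) 0   ≤⟨ U.*≤* (ℤₚ.*-monoʳ-≤-nonNeg (+ 1) (ℤ.+≤+ a≤b)) ⟩
  U.mkℚᵘ (+ b) 0   ≃⟨ toℚᵘ-/ b 0 ⟨
  toℚᵘ (ℕ→ℚ b)     ∎)
  where open Uₚ.≤-Reasoning

ℕ→ℚ-cancel : ∀ {a b} → ℕ→ℚ a Q.≤ ℕ→ℚ b → a ≤ b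
ℕ→ℚ-cancel {a} {b} p = unwrap (begin
  U.mkℚᵘ (+ a) 0   ≃⟨ toℚᵘ-/ a 0 ⟨
  toℚᵘ (ℕ→ℚ a)     ≤⟨ Qₚ.toℚᵘ-mono-≤ p ⟩
  toℚᵘ (ℕ→ℚ b)     ≃⟨ toℚᵘ-/ b 0 ⟩
  U.mkℚᵘ (+ b) 0   ∎)
  where
  open Uₚ.≤-Reasoning
  unwrap : U.mkℚᵘ (+ a) 0 U.≤ U.mkℚᵘ (+ b) 0 → a ≤ b
  unwrap (U.*≤* q) = ℤₚ.drop‿+≤+ (subst₂ ℤ._≤_ (ℤₚ.*-identityʳ (+ a)) (ℤₚ.*-identityʳ (+ b)) q)

-- The product is the numerator of ε, a positive integer.
1≤denominator*ε : ∀ ε → 0ℚ < ε → 1ℚ Q.≤ ℕ→ℚ (↧ₙ ε) * ε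
1≤denominator*ε ε 0<ε = subst (1ℚ Q.≤_) (Qₚ.*-comm ε (ℕ→ℚ (↧ₙ ε))) (scaled ε (Q.positive 0<ε))
  where
  scaled : ∀ ε → Positive ε → 1ℚ Q.≤ ε * ℕ→ℚ (↧ₙ ε)
  scaled ε@(mkℚ ℤ.+[1+ p ] d _) _ = subst (1ℚ Q.≤_)
    (trans (sym (/-*-cancel (N.suc p) d)) (cong (_* ℕ→ℚ (N.suc d)) (Qₚ.↥p/↧p≡p ε)))
    (ℕ→ℚ-mono {1} {N.suc p} (N.s≤s N.z≤n))

^ℚ-unit : ∀ {x} → 0ℚ Q.≤ x → x Q.≤ 1ℚ → ∀ k → x ^ℚ k Q.≤ 1ℚ
^ℚ-unit 0≤x x≤1 N.zero = Qₚ.≤-refl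
^ℚ-unit {x} 0≤x x≤1 (N.suc k) = begin
  x * x ^ℚ k  ≤⟨ Qₚ.*-monoˡ-≤-nonNeg x {{Q.nonNegative 0≤x}} (^ℚ-unit 0≤x x≤1 k) ⟩
  x * 1ℚ      ≡⟨ Qₚ.*-identityʳ x ⟩
  x           ≤⟨ x≤1 ⟩
  1ℚ          ∎
  where open Qₚ.≤-Reasoning

-- For x ≤ 1 the power x^(k+1) is at most x, so a scale which makes ε at least 1 does the same for x.
scale-root : ∀ {K ε x} k → 1ℚ Q.≤ K → 1ℚ Q.≤ K * ε → 0ℚ Q.≤ x → ε < x ^ℚ N.suc k → 1ℚ Q.≤ K * x
scale-root {K} {ε} {x} k 1≤K 1≤Kε 0≤x ε<xᵏ = Qₚ.≮⇒≥ λ Kx<1 → Qₚ.<-irrefl refl (begin-strict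
  K * x              <⟨ Kx<1 ⟩
  1ℚ                 ≤⟨ 1≤Kε ⟩
  K * ε              ≤⟨ Qₚ.*-monoˡ-≤-nonNeg K {{K≥0}} (Qₚ.<⇒≤ ε<xᵏ) ⟩
  K * (x * x ^ℚ k)   ≤⟨ Qₚ.*-monoˡ-≤-nonNeg K {{K≥0}} (Qₚ.*-monoˡ-≤-nonNeg x {{x≥0}} (^ℚ-unit 0≤x (x≤1 Kx<1) k)) ⟩
  K * (x * 1ℚ)       ≡⟨ cong (K *_) (Qₚ.*-identityʳ x) ⟩
  K * x              ∎)
  where
  open Qₚ.≤-Reasoning
  K≥0 : NonNegative K
  K≥0 = Q.nonNegative (Qₚ.≤-trans (ℕ→ℚ-mono {0} {1} N.z≤n) 1≤K)
  x≥0 : NonNegative x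
  x≥0 = Q.nonNegative 0≤x
  x≤1 : K * x < 1ℚ → x Q.≤ 1ℚ
  x≤1 Kx<1 = begin
    x        ≡⟨ Qₚ.*-identityˡ x ⟨
    1ℚ * x   ≤⟨ Qₚ.*-monoʳ-≤-nonNeg x {{x≥0}} 1≤K ⟩
    K * x    ≤⟨ Qₚ.<⇒≤ Kx<1 ⟩
    1ℚ       ∎

-- Density and the number of edges.

density-* : ∀ {n} (G : Graph n) X Y → 0ℚ < density G X Y →
  density G X Y * ℕ→ℚ (∣ X ∣ N.* ∣ Y ∣) ≡ ℕ→ℚ (eXY G X Y)
density-* G X Y 0<d with ∣ X ∣ N.* ∣ Y ∣
-- Here the density takes its default value 0, which positivity excludes.
... | N.zero  = contradiction 0<d (Qₚ.<-irrefl refl)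
... | N.suc m = /-*-cancel (eXY G X Y) m

-- Doubling counts both darts of every crossing edge, and a dart crosses in at most one of the two
-- directions.
eXY≤eG : ∀ {n} (G : Graph n) V → eXY G V (∁ V) ≤ eG G
eXY≤eG {n} G V = Nₚ.*-cancelˡ-≤ 2 (begin
  2 N.* eXY G V (∁ V)                                          ≡⟨ cong (λ t → t N.+ (t N.+ 0)) expand ⟩
  2 N.* S
    ≡⟨ cong (S N.+_) (trans (Nₚ.+-identityʳ S) (sumFin-swap cross)) ⟩
  S N.+ sumFin (λ x → sumFin (λ y → cross y x))
    ≡⟨ sumFin-+ (λ x → sumFin (cross x)) (λ x → sumFin (λ y → cross y x)) ⟨
  sumFin (λ x → sumFin (cross x) N.+ sumFin (λ y → cross y x)) ≡⟨ sumFin-cong (λ x → sumFin-+ (cross x) (λ y → cross y x)) ⟨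
  sumFin (λ x → sumFin (λ y → cross x y N.+ cross y x))        ≤⟨ sumFin-mono (λ x → sumFin-mono (pointwise x)) ⟩
  dartSum G (λ _ → 1)                                          ≡⟨ dartSum-1 G ⟩
  2 N.* eG G                                                   ∎)
  where
  open Nₚ.≤-Reasoning
  cross : Fin n → Fin n → ℕ
  cross x y = ⟦ lookup V x ∧ lookup (∁ V) y ∧ adj G x y ⟧
  S = sumFin (λ x → sumFin (cross x))
  expand : eXY G V (∁ V) ≡ S
  expand = sumFin-cong λ x → count-sumFin (λ y → lookup V x ∧ lookup (∁ V) y ∧ adj G x y)
  pointwise : ∀ x y → cross x y N.+ cross y x ≤ (if adj G x y then 1 else 0)
  pointwise x y rewrite lookup-map x not V | lookup-map y not V | Graph.sym G y x
    with lookup V x | lookup V y | adj G x y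
  ... | true  | true  | _     = N.z≤n
  ... | true  | false | true  = Nₚ.≤-refl
  ... | true  | false | false = N.z≤n
  ... | false | true  | true  = Nₚ.≤-refl
  ... | false | true  | false = N.z≤n
  ... | false | false | _     = N.z≤n

-- The difference (a + b)² - 4ab is (b - a)², which is 0 or 1; the two cases avoid subtraction.
balanced-product-ordered : ∀ a b → a ≤ b → b ≤ a N.+ 1 → (a N.+ b) N.* (a N.+ b) ≤ 4 N.* (a N.* b) N.+ 1
balanced-product-ordered a b a≤b b≤a+1 with Nₚ.m≤n⇒m<n∨m≡n a≤b
... | inj₂ refl = Nₚ.≤-trans (Nₚ.≤-reflexive (even a)) (Nₚ.m≤m+n _ 1)
  where
  even : ∀ a → (a N.+ a) N.* (a N.+ a) ≡ 4 N.* (a N.* a)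
  even = solve-∀
... | inj₁ a<b with Nₚ.≤-antisym b≤a+1 (Nₚ.≤-trans (Nₚ.≤-reflexive (Nₚ.+-comm a 1)) a<b)
...   | refl = Nₚ.≤-reflexive (odd a)
  where
  odd : ∀ a → (a N.+ (a N.+ 1)) N.* (a N.+ (a N.+ 1)) ≡ 4 N.* (a N.* (a N.+ 1)) N.+ 1
  odd = solve-∀

balanced-product : ∀ a b → a ≤ b N.+ 1 → b ≤ a N.+ 1 → (a N.+ b) N.* (a N.+ b) ≤ 4 N.* (a N.* b) N.+ 1
balanced-product a b a≤b+1 b≤a+1 with Nₚ.≤-total a b
... | inj₁ a≤b = balanced-product-ordered a b a≤b b≤a+1
... | inj₂ b≤a = subst₂ _≤_ (cong (λ t → t N.* t) (Nₚ.+-comm b a)) (cong (λ t → 4 N.* t N.+ 1) (Nₚ.*-comm b a))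
                   (balanced-product-ordered b a b≤a a≤b+1)

-- Balance gives n² ≤ 4ab + 1 for the sizes a, b of the two sides. Since K d / 4 ≥ 1, the product
-- 4ab is at most K d a b, which is `K` times the number of crossing edges.
dense-edges : ∀ {n} (G : Graph n) (V₁ : Subset n) (K : ℕ) →
  ∣ V₁ ∣ ≤ ∣ ∁ V₁ ∣ N.+ 1 → ∣ ∁ V₁ ∣ ≤ ∣ V₁ ∣ N.+ 1 → 0ℚ < density G V₁ (∁ V₁) →
  1ℚ Q.≤ ℕ→ℚ K * (density G V₁ (∁ V₁) * ((+ 1) / 4)) → n N.* n ≤ K N.* eG G N.+ 1
dense-edges {n} G V₁ K bal₁ bal₂ 0<d 1≤Kd = begin
  n N.* n                                ≡⟨ cong (λ t → t N.* t) parts ⟩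
  (a N.+ b) N.* (a N.+ b)                ≤⟨ balanced-product a b bal₁ bal₂ ⟩
  4 N.* (a N.* b) N.+ 1                  ≤⟨ Nₚ.+-monoˡ-≤ 1 (ℕ→ℚ-cancel scaled) ⟩
  K N.* eXY G V₁ (∁ V₁) N.+ 1            ≤⟨ Nₚ.+-monoˡ-≤ 1 (Nₚ.*-monoʳ-≤ K (eXY≤eG G V₁)) ⟩
  K N.* eG G N.+ 1                       ∎
  where
  open Nₚ.≤-Reasoning
  a = ∣ V₁ ∣
  b = ∣ ∁ V₁ ∣
  d = density G V₁ (∁ V₁)
  ¼ = (+ 1) / 4
  parts : n ≡ a N.+ b
  parts = sym (trans (cong (a N.+_) (∣∁p∣≡n∸∣p∣ V₁)) (Nₚ.m+[n∸m]≡n (∣p∣≤n V₁)))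
  regroup : ∀ k d q f m → k * (d * q) * (f * m) ≡ k * (d * m) * (q * f)
  regroup = solve 5 (λ k d q f m → k :* (d :* q) :* (f :* m) := k :* (d :* m) :* (q :* f)) refl
    where open +-*-Solver
  scaled : ℕ→ℚ (4 N.* (a N.* b)) Q.≤ ℕ→ℚ (K N.* eXY G V₁ (∁ V₁))
  scaled = R.begin
    ℕ→ℚ (4 N.* (a N.* b))                            R.≡⟨ Qₚ.*-identityˡ _ ⟨
    1ℚ * ℕ→ℚ (4 N.* (a N.* b))
      R.≤⟨ Qₚ.*-monoʳ-≤-nonNeg _ {{Q.nonNegative (ℕ→ℚ-mono {0} {4 N.* (a N.* b)} N.z≤n)}} 1≤Kd ⟩
    ℕ→ℚ K * (d * ¼) * ℕ→ℚ (4 N.* (a N.* b))          R.≡⟨ cong (ℕ→ℚ K * (d * ¼) *_) (ℕ→ℚ-* 4 (a N.* b)) ⟩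
    ℕ→ℚ K * (d * ¼) * (ℕ→ℚ 4 * ℕ→ℚ (a N.* b))        R.≡⟨ regroup (ℕ→ℚ K) d ¼ (ℕ→ℚ 4) (ℕ→ℚ (a N.* b)) ⟩
    -- The closed factor `¼ * ℕ→ℚ 4` computes to `1ℚ`.
    ℕ→ℚ K * (d * ℕ→ℚ (a N.* b)) * (¼ * ℕ→ℚ 4)        R.≡⟨ Qₚ.*-identityʳ _ ⟩
    ℕ→ℚ K * (d * ℕ→ℚ (a N.* b))                      R.≡⟨ cong (ℕ→ℚ K *_) (density-* G V₁ (∁ V₁) 0<d) ⟩
    ℕ→ℚ K * ℕ→ℚ (eXY G V₁ (∁ V₁))                    R.≡⟨ ℕ→ℚ-* K (eXY G V₁ (∁ V₁)) ⟨
    ℕ→ℚ (K N.* eXY G V₁ (∁ V₁))                      R.∎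
    where module R = Qₚ.≤-Reasoning

-- From the scaled natural bounds to the rational ones.

module _ (K e g : ℕ) (ε : ℚ) (1≤Kε : 1ℚ Q.≤ ℕ→ℚ (N.suc K) * ε) where

  private
    ¼ = (+ 1) / 4
    k = ℕ→ℚ (N.suc K)
    E = ℕ→ℚ e
    γ = ℕ→ℚ g
    t = ℕ→ℚ 10

    k>0 : Positive k
    k>0 = Qₚ.normalize-pos (N.suc K) 1

    -- The admissible error 10 ε e, scaled by `k`; it is at least 10 e because k ε ≥ 1.
    error : ℚ
    error = t * (k * ε * E)

    10E≤error : ℕ→ℚ (10 N.* e) Q.≤ error
    10E≤error = begin
      ℕ→ℚ (10 N.* e)     ≡⟨ ℕ→ℚ-* 10 e ⟩
      t * E              ≡⟨ cong (t *_) (Qₚ.*-identityˡ E) ⟨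
      t * (1ℚ * E)       ≤⟨ Qₚ.*-monoˡ-≤-nonNeg t (Qₚ.*-monoʳ-≤-nonNeg E {{Q.nonNegative (ℕ→ℚ-mono {0} {e} N.z≤n)}} 1≤Kε) ⟩
      error              ∎
      where open Qₚ.≤-Reasoning

    quarter : ¼ * ℕ→ℚ (N.suc K N.* (4 N.* g)) ≡ k * γ
    quarter = trans (cong (¼ *_) (trans (ℕ→ℚ-* (N.suc K) (4 N.* g)) (cong (k *_) (ℕ→ℚ-* 4 g))))
      (trans (regroup ¼ k (ℕ→ℚ 4) γ) (Qₚ.*-identityˡ (k * γ)))
      where
      open +-*-Solver
      regroup : ∀ q k f γ → q * (k * (f * γ)) ≡ q * f * (k * γ)
      regroup = solve 4 (λ q k f γ → q :* (k :* (f :* γ)) := q :* f :* (k :* γ)) refl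

  lower-ℚ : N.suc K N.* e ≤ N.suc K N.* (4 N.* g) N.+ 10 N.* e → ¼ * (1ℚ - t * ε) * E Q.≤ γ
  lower-ℚ h = Qₚ.*-cancelˡ-≤-pos k {{k>0}} (begin
    k * (¼ * (1ℚ - t * ε) * E)                           ≡⟨ expand k ¼ t ε E ⟩
    ¼ * (k * E - error)                                  ≤⟨ Qₚ.*-monoˡ-≤-nonNeg ¼ (Qₚ.+-monoˡ-≤ (- error) bound) ⟩
    ¼ * (ℕ→ℚ (N.suc K N.* (4 N.* g)) + error - error)    ≡⟨ cong (¼ *_) (cancel (ℕ→ℚ (N.suc K N.* (4 N.* g))) error) ⟩
    ¼ * ℕ→ℚ (N.suc K N.* (4 N.* g))                      ≡⟨ quarter ⟩
    k * γ                                                ∎)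
    where
    open Qₚ.≤-Reasoning
    open +-*-Solver
    expand : ∀ k q t ε E → k * (q * (1ℚ - t * ε) * E) ≡ q * (k * E - t * (k * ε * E))
    expand = solve 5 (λ k q t ε E → k :* (q :* (con 1ℚ :- t :* ε) :* E) := q :* (k :* E :- t :* (k :* ε :* E))) refl
    cancel : ∀ x y → x + y - y ≡ x
    cancel = solve 2 (λ x y → x :+ y :- y := x) refl
    bound : k * E Q.≤ ℕ→ℚ (N.suc K N.* (4 N.* g)) + error
    bound = begin
      k * E                                              ≡⟨ ℕ→ℚ-* (N.suc K) e ⟨
      ℕ→ℚ (N.suc K N.* e)                                ≤⟨ ℕ→ℚ-mono h ⟩
      ℕ→ℚ (N.suc K N.* (4 N.* g) N.+ 10 N.* e)           ≡⟨ ℕ→ℚ-+ (N.suc K N.* (4 N.* g)) (10 N.* e) ⟩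
      ℕ→ℚ (N.suc K N.* (4 N.* g)) + ℕ→ℚ (10 N.* e)       ≤⟨ Qₚ.+-monoʳ-≤ (ℕ→ℚ (N.suc K N.* (4 N.* g))) 10E≤error ⟩
      ℕ→ℚ (N.suc K N.* (4 N.* g)) + error                ∎

  upper-ℚ : N.suc K N.* (4 N.* g) ≤ N.suc K N.* e N.+ 10 N.* e → γ Q.≤ ¼ * (1ℚ + t * ε) * E
  upper-ℚ h = Qₚ.*-cancelˡ-≤-pos k {{k>0}} (begin
    k * γ                                                ≡⟨ quarter ⟨
    ¼ * ℕ→ℚ (N.suc K N.* (4 N.* g))                      ≤⟨ Qₚ.*-monoˡ-≤-nonNeg ¼ bound ⟩
    ¼ * (k * E + error)                                  ≡⟨ expand k ¼ t ε E ⟨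
    k * (¼ * (1ℚ + t * ε) * E)                           ∎)
    where
    open Qₚ.≤-Reasoning
    open +-*-Solver
    expand : ∀ k q t ε E → k * (q * (1ℚ + t * ε) * E) ≡ q * (k * E + t * (k * ε * E))
    expand = solve 5 (λ k q t ε E → k :* (q :* (con 1ℚ :+ t :* ε) :* E) := q :* (k :* E :+ t :* (k :* ε :* E))) refl
    bound : ℕ→ℚ (N.suc K N.* (4 N.* g)) Q.≤ k * E + error
    bound = begin
      ℕ→ℚ (N.suc K N.* (4 N.* g))                        ≤⟨ ℕ→ℚ-mono h ⟩
      ℕ→ℚ (N.suc K N.* e N.+ 10 N.* e)                   ≡⟨ ℕ→ℚ-+ (N.suc K N.* e) (10 N.* e) ⟩
      ℕ→ℚ (N.suc K N.* e) + ℕ→ℚ (10 N.* e)               ≤⟨ Qₚ.+-mono-≤ (Qₚ.≤-reflexive (ℕ→ℚ-* (N.suc K) e)) 10E≤error ⟩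
      k * E + error                                      ∎

theorem1p4 : (ε : ℚ) → 0ℚ < ε →
    ∃[ n₀ ] (∀ (n : ℕ) (G : Graph n) (V₁ : Subset n) →
    IsBipartition G V₁ →
    ∣ V₁ ∣ ≤ ∣ ∁ V₁ ∣ N.+ 1 → ∣ ∁ V₁ ∣ ≤ ∣ V₁ ∣ N.+ 1 →
    Quasirandom G ε V₁ (∁ V₁) →
    0ℚ < density G V₁ (∁ V₁) →
    ε < (density G V₁ (∁ V₁) * ((+ 1) / 4)) ^ℚ 16 →
    n₀ ≤ n →
    ∀ (g : ℕ) → IsGenus G g →
    ((+ 1) / 4) * (1ℚ - ℕ→ℚ 10 * ε) * ℕ→ℚ (eG G) Q.≤ ℕ→ℚ g
    × ℕ→ℚ g Q.≤ ((+ 1) / 4) * (1ℚ + ℕ→ℚ 10 * ε) * ℕ→ℚ (eG G))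
theorem1p4 ε 0<ε = threshold K , λ n G V₁ bip bal₁ bal₂ _ 0<d ε<d large g isg →
  let d      = density G V₁ (∁ V₁)
      0≤d/4  = Qₚ.nonNegative⁻¹ (d * ((+ 1) / 4))
                 {{Qₚ.nonNeg*nonNeg⇒nonNeg d {{Q.nonNegative (Qₚ.<⇒≤ 0<d)}} ((+ 1) / 4)}}
      -- The exponent 16 is 15 + 1, so the scale chosen for ε also brings a quarter of the density
      -- up to at least 1.
      1≤Kd   = scale-root 15 (ℕ→ℚ-mono {1} {N.suc K} (N.s≤s N.z≤n)) 1≤Kε 0≤d/4 ε<d
      bounds = genus-bounds K G V₁ bip large (dense-edges G V₁ (N.suc K) bal₁ bal₂ 0<d 1≤Kd) isg
  in lower-ℚ K (eG G) g ε 1≤Kε (proj₁ bounds) , upper-ℚ K (eG G) g ε 1≤Kε (proj₂ bounds)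
  where
  -- `N.suc K` is the denominator of ε, so the threshold depends on ε alone.
  K = ℚ.denominator-1 ε
  1≤Kε = 1≤denominator*ε ε 0<ε
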